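{- Let $n\ge 4$ and consider peg solitaire on the triangular board $T_n$. Start from the position in which every hole of $T_n$ holds a peg except the single hole with skew coordinates $(x_s,y_s)$. Then the following are equivalent: (A) there is no sequence of jumps from this starting position that ends in a position with exactly one peg (at any hole); (B) $n\equiv 1 \pmod 3$ and $x_s+y_s\equiv 0 \pmod 3$.
   Context: The triangular board $T_n$ is the set of holes with integer skew coordinates $(x,y)$ satisfying $0\le x\le y\le n-1$ (so $T_n$ has $n(n+1)/2$ holes; $y$ indexes the row, with the top corner at $(0,0)$ and the bottom row $y=n-1$). A board position assigns to each hole either a peg or no peg. A jump takes a peg at hole $p$, jumps it over a peg at an adjacent hole $p+d$ into an empty hole $p+2d$, where $d$ is one of the six directions $(\pm1,0)$, $(0,\pm1)$, $(1,1)$, $(-1,-1)$ and all three holes $p,p+d,p+2d$ lie in $T_n$; the jumped-over peg at $p+d$ is removed. Thus each jump reduces the number of pegs by one. -}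

module Defs where

open import Data.Bool using (Bool; true; false; not)
open import Data.Integer using (ℤ; +_; 0ℤ; 1ℤ; -1ℤ) renaming (_+_ to _+ℤ_)
open import Data.Nat using (ℕ; _≤_; _<_)
open import Data.Nat.Properties using (_≟_)
open import Data.Product using (_×_; _,_; ∃; ∃!)
open import Relation.Binary.Construct.Closure.ReflexiveTransitive using (Star)
open import Relation.Binary.Definitions using (DecidableEquality)
open import Relation.Binary.PropositionalEquality using (_≡_; _≢_; refl; cong)
open import Relation.Nullary using (yes; no; does)

-- The bounds are irrelevant, so a hole is determined by its coordinates.
record Hole (n : ℕ) : Set where
  constructor hole
  field
    x y  : ℕ
    .x≤y : x ≤ y
    .y<n : y < n

open Hole public using (x; y)

_≟ₕ_ : ∀ {n} → DecidableEquality (Hole n)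
hole x₁ y₁ _ _ ≟ₕ hole x₂ y₂ _ _ with x₁ ≟ x₂ | y₁ ≟ y₂
... | yes refl | yes refl = yes refl
... | no x₁≢x₂ | _        = no λ h → x₁≢x₂ (cong x h)
... | yes _    | no y₁≢y₂ = no λ h → y₁≢y₂ (cong y h)

ℤ² : Set
ℤ² = ℤ × ℤ

_⊕_ : ℤ² → ℤ² → ℤ²
(a , b) ⊕ (c , d) = (a +ℤ c) , (b +ℤ d)

infixl 6 _⊕_

coords : ∀ {n} → Hole n → ℤ²
coords h = + x h , + y h

data Direction : ℤ² → Set where
  +x  : Direction (1ℤ , 0ℤ)
  -x  : Direction (-1ℤ , 0ℤ)
  +y  : Direction (0ℤ , 1ℤ)
  -y  : Direction (0ℤ , -1ℤ)
  +xy : Direction (1ℤ , 1ℤ)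
  -xy : Direction (-1ℤ , -1ℤ)

-- true: the hole holds a peg; false: it is empty.
Position : ℕ → Set
Position n = Hole n → Bool

-- Positions are compared hole by hole, so no function extensionality is needed.
record Jump {n : ℕ} (P Q : Position n) : Set where
  field
    {d}       : ℤ²
    direction : Direction d
    p q r     : Hole n
    q≡p+d     : coords q ≡ coords p ⊕ d
    r≡p+2d    : coords r ≡ coords p ⊕ d ⊕ d
    p-before  : P p ≡ true
    q-before  : P q ≡ true
    r-before  : P r ≡ false
    p-after   : Q p ≡ false
    q-after   : Q q ≡ false
    r-after   : Q r ≡ true
    unchanged : ∀ h → h ≢ p → h ≢ q → h ≢ r → Q h ≡ P h

_⟶*_ : ∀ {n} → Position n → Position n → Set
_⟶*_ = Star Jump

ExactlyOnePeg : ∀ {n} → Position n → Set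
ExactlyOnePeg P = ∃! _≡_ λ h → P h ≡ true

SolvableToOnePeg : ∀ {n} → Position n → Set
SolvableToOnePeg P = ∃ λ Q → P ⟶* Q × ExactlyOnePeg Q

singleVacancy : ∀ {n} → Hole n → Position n
singleVacancy s h = not (does (h ≟ₕ s))

{-# OPTIONS --safe #-}
module Submission where

-- Colour the hole (x , y) by x + y mod 3.  Every jump involves one hole of each colour, so a
-- Boolean weight on the colours with sum 0 has an invariant total over the pegs.  In the position
-- described by (B) all these totals vanish, but for a single peg one of them does not.
--
-- Conversely, outside (B) one shows for n ≥ 6, by induction in steps of 3, that the board can be
-- reduced to one peg on the bottom row within distance 2 of a corner.  For n ≥ 9 the vacancy lies
-- in one of the three corner subtriangles T_{n-3}.  By induction and symmetry that subtriangle is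
-- reduced to one peg on the side facing the three remaining full rows, close to an end of that
-- side; together with this peg the three rows are then cleared by local manoeuvres, two columns
-- at a time, so that the last peg is at whichever end is desired.  Local manoeuvres and the boards
-- with n ≤ 8 are explicit plays found by computer search.

open import Algebra.Bundles using (CommutativeRing)
import Algebra.Properties.CommutativeSemigroup as CommutativeSemigroupProperties
open import Data.Bool using (Bool; true; false; not; _∧_; _∨_; _xor_; if_then_else_; T)
open import Data.Bool.ListAction using (all; any)
open import Data.Bool.Properties
  using (T-∧; T-∨; T-≡; T-not-≡; ¬-not; ∧-zeroʳ; ∧-identityʳ; ∧-distribˡ-xor;
         xor-assoc; xor-comm; xor-same; xor-identityʳ; xor-∧-commutativeRing)
open import Data.Empty using (⊥-elim)
import Data.Empty.Irrelevant as Irrelevant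
open import Data.Fin using (Fin; zero; suc; toℕ; fromℕ<)
open import Data.Fin.Properties using (toℕ-fromℕ<; toℕ≤pred[n])
open import Data.Integer as ℤ using (+_; 0ℤ; 1ℤ; -1ℤ)
import Data.Integer.Properties as ℤ
open import Data.List using (List; []; _∷_)
open import Data.List.Membership.Propositional using (find)
open import Data.List.Relation.Unary.All using (lookup)
open import Data.List.Relation.Unary.All.Properties using (all⁺)
open import Data.List.Relation.Unary.Any.Properties using (any⁻)
open import Data.Nat
open import Data.Nat.DivMod using (m≡m%n+[m/n]*n; [m+kn]%n≡m%n)
open import Data.Nat.Properties
open import Data.Nat.Solver using (module +-*-Solver)
open import Data.Product using (_×_; _,_; ∃; proj₁; proj₂)
open import Data.Sum using (_⊎_; inj₁; inj₂)
open import Data.Unit using (⊤; tt)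
open import Function using (_∘_; case_of_)
open import Function.Bundles using (_⇔_; mk⇔; Equivalence)
open import Relation.Binary.Construct.Closure.ReflexiveTransitive using (ε; _◅_)
open import Relation.Binary.PropositionalEquality
open import Relation.Nullary using (¬_; Dec; yes; no; does; recompute)
open import Relation.Nullary.Decidable using (map′; _×-dec_; _⊎-dec_; dec-true; dec-false)
open import Relation.Unary using (Decidable)
open import Defs

-- The colour invariant also dictates the shape of the constructions. A jump flips the parity of all
-- three colour counts, so what survives is these parities up to a simultaneous flip. Three full
-- rows along a side are neutral: each transversal column of three cells contains every colour, and
-- so do the three cells left over in the last corner. Hence the board can grow by three rows at a
-- time, and three full rows plus one extra peg can only end in a peg of the colour of that extra
-- peg. Along a side the colours alternate cyclically, so the three cells next to a corner offer one
-- place for each colour: this explains the distance 2, and why each manoeuvre with the extra peg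
-- comes in three variants indexed by `Fin 3`. Asking for a last peg near a corner, rather than
-- anywhere, strengthens the induction so that the peg handed to the strip is always within reach of
-- a manoeuvre of bounded size.
--
-- In barycentric coordinates (B) says that all three coordinates are congruent modulo 3. This form
-- is symmetric and unchanged when 3 is subtracted from one coordinate, as the induction requires.

-- Positions in barycentric coordinates

-- Barycentric coordinates: the hole (x , y) of T_{N+1} is the cell (x , y − x , N − y), of size N.
record Cell : Set where
  constructor cell
  field a b c : ℕ

∣_∣ : Cell → ℕ
∣ cell a b c ∣ = a + b + c

_≟ᶜ_ : (g h : Cell) → Dec (g ≡ h)
cell a b c ≟ᶜ cell a′ b′ c′ =
  map′ (λ { (refl , refl , refl) → refl }) (λ { refl → refl , refl , refl })
       (c ≟ c′ ×-dec b ≟ b′ ×-dec a ≟ a′)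

-- Defined on all triples; a board enters only through `∣ h ∣ ≡ N`. Restricting to a window is then
-- mere precomposition, without proofs of bounds.
Pegs : Set
Pegs = Cell → Bool

_≈[_]_ : Pegs → ℕ → Pegs → Set
P ≈[ N ] Q = ∀ h → ∣ h ∣ ≡ N → P h ≡ Q h

vacancy single : Cell → Pegs
vacancy s h = not (does (h ≟ᶜ s))
single  t h = does (h ≟ᶜ t)

-- Each jump moves two units from one coordinate to another; the arguments of a constructor are
-- the coordinates minus these two units.
data Line : (p q r : Cell) → Set where
  ab : ∀ a b c → Line (cell (2 + a) b c) (cell (1 + a) (1 + b) c) (cell a (2 + b) c)
  ba : ∀ a b c → Line (cell a (2 + b) c) (cell (1 + a) (1 + b) c) (cell (2 + a) b c)
  ac : ∀ a b c → Line (cell (2 + a) b c) (cell (1 + a) b (1 + c)) (cell a b (2 + c))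
  ca : ∀ a b c → Line (cell a b (2 + c)) (cell (1 + a) b (1 + c)) (cell (2 + a) b c)
  bc : ∀ a b c → Line (cell a (2 + b) c) (cell a (1 + b) (1 + c)) (cell a b (2 + c))
  cb : ∀ a b c → Line (cell a b (2 + c)) (cell a (1 + b) (1 + c)) (cell a (2 + b) c)

line-size : ∀ {p q r} → Line p q r → ∣ q ∣ ≡ ∣ p ∣ × ∣ r ∣ ≡ ∣ p ∣
line-size (ab a b c) rewrite +-suc a (suc b) | +-suc a b = refl , refl
line-size (ba a b c) rewrite +-suc a (suc b) | +-suc a b = refl , refl
line-size (ac a b c) rewrite +-suc (a + b) (suc c) | +-suc (a + b) c = refl , refl
line-size (ca a b c) rewrite +-suc (a + b) (suc c) | +-suc (a + b) c = refl , refl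
line-size (bc a b c) rewrite +-suc a (suc b) | +-suc a b | +-suc (a + b) (suc c) | +-suc (a + b) c = refl , refl
line-size (cb a b c) rewrite +-suc a (suc b) | +-suc a b | +-suc (a + b) (suc c) | +-suc (a + b) c = refl , refl

line-distinct : ∀ {p q r} → Line p q r → p ≢ q × p ≢ r × q ≢ r
line-distinct (ab a b c) = (λ ()) , (λ ()) , (λ ())
line-distinct (ba a b c) = (λ ()) , (λ ()) , (λ ())
line-distinct (ac a b c) = (λ ()) , (λ ()) , (λ ())
line-distinct (ca a b c) = (λ ()) , (λ ()) , (λ ())
line-distinct (bc a b c) = (λ ()) , (λ ()) , (λ ())
line-distinct (cb a b c) = (λ ()) , (λ ()) , (λ ())

record Step (N : ℕ) (P Q : Pegs) : Set where
  field
    {p q r}   : Cell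
    line      : Line p q r
    p-size    : ∣ p ∣ ≡ N
    p-before  : P p ≡ true
    q-before  : P q ≡ true
    r-before  : P r ≡ false
    p-after   : Q p ≡ false
    q-after   : Q q ≡ false
    r-after   : Q r ≡ true
    unchanged : ∀ h → ∣ h ∣ ≡ N → h ≢ p → h ≢ q → h ≢ r → Q h ≡ P h

  q-size : ∣ q ∣ ≡ N
  q-size = trans (proj₁ (line-size line)) p-size

  r-size : ∣ r ∣ ≡ N
  r-size = trans (proj₂ (line-size line)) p-size

data Reach (N : ℕ) (P Q : Pegs) : Set where
  done : P ≈[ N ] Q → Reach N P Q
  next : ∀ {P′} → Step N P P′ → Reach N P′ Q → Reach N P Q

step-resp : ∀ {N P P′ Q} → P′ ≈[ N ] P → Step N P Q → Step N P′ Q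
step-resp eq s = record
  { line = line ; p-size = p-size
  ; p-before = trans (eq _ p-size) p-before
  ; q-before = trans (eq _ q-size) q-before
  ; r-before = trans (eq _ r-size) r-before
  ; p-after = p-after ; q-after = q-after ; r-after = r-after
  ; unchanged = λ h ∣h∣ h≢p h≢q h≢r → trans (unchanged h ∣h∣ h≢p h≢q h≢r) (sym (eq h ∣h∣)) }
  where open Step s

reach-resp : ∀ {N P P′ Q} → P′ ≈[ N ] P → Reach N P Q → Reach N P′ Q
reach-resp eq (done P≈Q) = done λ h ∣h∣ → trans (eq h ∣h∣) (P≈Q h ∣h∣)
reach-resp eq (next s r) = next (step-resp eq s) r

reach-trans : ∀ {N P Q R} → Reach N P Q → Reach N Q R → Reach N P R
reach-trans (done P≈Q) Q↝R = reach-resp P≈Q Q↝R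
reach-trans (next s r) Q↝R = next s (reach-trans r Q↝R)

-- Transporting plays: symmetries and subtriangles

record Embedding (M N : ℕ) : Set where
  field
    to        : Cell → Cell
    to-line   : ∀ {p q r} → Line p q r → Line (to p) (to q) (to r)
    to-size   : ∀ {h} → ∣ h ∣ ≡ M → ∣ to h ∣ ≡ N
    from-size : ∀ {h} → ∣ to h ∣ ≡ N → ∣ h ∣ ≡ M
    injective : ∀ {g h} → to g ≡ to h → g ≡ h
    image?    : ∀ h → Dec (∃ λ g → to g ≡ h)

  Outside : Cell → Set
  Outside h = ∀ g → to g ≢ h

  private
    paste : Pegs → Pegs → Pegs
    paste P R h with image? h
    ... | yes (g , _) = P g
    ... | no  _       = R h

    paste-in : ∀ P R g → paste P R (to g) ≡ P g
    paste-in P R g with image? (to g)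
    ... | yes (g′ , eq) = cong P (injective eq)
    ... | no  ¬im       = ⊥-elim (¬im (g , refl))

    paste-out : ∀ P R h → Outside h → paste P R h ≡ R h
    paste-out P R h out with image? h
    ... | yes (g , eq) = ⊥-elim (out g eq)
    ... | no  _        = refl

  cases : ∀ {ℓ} {A : Cell → Set ℓ} → (∀ g → A (to g)) → (∀ h → Outside h → A h) → ∀ h → A h
  cases {A = A} inside outside h with image? h
  ... | yes (g , refl) = inside g
  ... | no  ¬im        = outside h λ g eq → ¬im (g , eq)

  -- Since `to` preserves lines, each jump of the small board is a jump of the large one. The
  -- intermediate positions are pasted from the small position on the image and the initial `P′`
  -- elsewhere, so the outside is never touched.
  embed : ∀ {P Q P′ Q′} → Reach M P Q → (P′ ∘ to) ≈[ M ] P → (Q′ ∘ to) ≈[ M ] Q →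
          (∀ h → ∣ h ∣ ≡ N → Outside h → P′ h ≡ Q′ h) → Reach N P′ Q′
  embed {P′ = P′} {Q′} (done P≈Q) inP inQ out = done (cases
    (λ g ∣g∣ → let m = from-size {g} ∣g∣ in trans (inP g m) (trans (P≈Q g m) (sym (inQ g m))))
    λ h o ∣h∣ → out h ∣h∣ o)
  embed {P′ = P′} {Q′} (next {P₁} s rest) inP inQ out = next s′
    (embed rest (λ g _ → paste-in P₁ P′ g) inQ
      λ h ∣h∣ o → trans (paste-out P₁ P′ h o) (out h ∣h∣ o))
    where
    open Step s
    s′ : Step N P′ (paste P₁ P′)
    s′ = record
      { line = to-line line ; p-size = to-size p-size
      ; p-before = trans (inP _ p-size) p-before
      ; q-before = trans (inP _ q-size) q-before
      ; r-before = trans (inP _ r-size) r-before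
      ; p-after = trans (paste-in P₁ P′ p) p-after
      ; q-after = trans (paste-in P₁ P′ q) q-after
      ; r-after = trans (paste-in P₁ P′ r) r-after
      ; unchanged = cases
          (λ g ∣g∣ g≢p g≢q g≢r → let m = from-size {g} ∣g∣ in
            trans (paste-in P₁ P′ g)
              (trans (unchanged g m (g≢p ∘ cong to) (g≢q ∘ cong to) (g≢r ∘ cong to))
                (sym (inP g m))))
          λ h o _ _ _ _ → paste-out P₁ P′ h o }

  single-in : ∀ t g → single (to t) (to g) ≡ single t g
  single-in t g with g ≟ᶜ t
  ... | yes refl = trans (dec-true (to g ≟ᶜ to g) refl) (sym (dec-true (g ≟ᶜ g) refl))
  ... | no  g≢t  = trans (dec-false (to g ≟ᶜ to t) (g≢t ∘ injective)) (sym (dec-false (g ≟ᶜ t) g≢t))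

  single-out : ∀ t h → Outside h → single (to t) h ≡ false
  single-out t h o = dec-false (h ≟ᶜ to t) λ eq → o t (sym eq)

  embed-single : ∀ {P P′ t} → Reach M P (single t) → (P′ ∘ to) ≈[ M ] P →
                 (∀ h → ∣ h ∣ ≡ N → Outside h → P′ h ≡ false) → Reach N P′ (single (to t))
  embed-single {t = t} r inP out = embed r inP (λ g _ → single-in t g)
    λ h ∣h∣ o → trans (out h ∣h∣ o) (sym (single-out t h o))

open Embedding using (embed; embed-single; Outside; to)

Solves : ℕ → Cell → Cell → Set
Solves N s t = Reach N (vacancy s) (single t)

symmetry : ∀ {N s t} (e : Embedding N N) → (∀ h → ∃ λ g → to e g ≡ h) →
           Solves N s t → Solves N (to e s) (to e t)
symmetry {s = s} {t} e onto r =
  embed e r (λ g _ → cong not (Embedding.single-in e s g)) (λ g _ → Embedding.single-in e t g)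
    λ h _ o → let g , eq = onto h in ⊥-elim (o g eq)

swapᵃᵇ swapᵇᶜ : Cell → Cell
swapᵃᵇ (cell a b c) = cell b a c
swapᵇᶜ (cell a b c) = cell a c b

swapᵃᵇ-size : ∀ h → ∣ swapᵃᵇ h ∣ ≡ ∣ h ∣
swapᵃᵇ-size (cell a b c) = cong (_+ c) (+-comm b a)

swapᵇᶜ-size : ∀ h → ∣ swapᵇᶜ h ∣ ≡ ∣ h ∣
swapᵇᶜ-size (cell a b c) = solve 3 (λ a b c → a :+ c :+ b := a :+ b :+ c) refl a b c
  where open +-*-Solver

swapᵃᵇ-line : ∀ {p q r} → Line p q r → Line (swapᵃᵇ p) (swapᵃᵇ q) (swapᵃᵇ r)
swapᵃᵇ-line (ab a b c) = ba b a c
swapᵃᵇ-line (ba a b c) = ab b a c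
swapᵃᵇ-line (ac a b c) = bc b a c
swapᵃᵇ-line (ca a b c) = cb b a c
swapᵃᵇ-line (bc a b c) = ac b a c
swapᵃᵇ-line (cb a b c) = ca b a c

swapᵇᶜ-line : ∀ {p q r} → Line p q r → Line (swapᵇᶜ p) (swapᵇᶜ q) (swapᵇᶜ r)
swapᵇᶜ-line (ab a b c) = ac a c b
swapᵇᶜ-line (ba a b c) = ca a c b
swapᵇᶜ-line (ac a b c) = ab a c b
swapᵇᶜ-line (ca a b c) = ba a c b
swapᵇᶜ-line (bc a b c) = cb a c b
swapᵇᶜ-line (cb a b c) = bc a c b

solves-swapᵃᵇ : ∀ {N s t} → Solves N s t → Solves N (swapᵃᵇ s) (swapᵃᵇ t)
solves-swapᵃᵇ = symmetry
  (record { to = swapᵃᵇ ; to-line = swapᵃᵇ-line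
          ; to-size = λ {h} → trans (swapᵃᵇ-size h) ; from-size = λ {h} → trans (sym (swapᵃᵇ-size h))
          ; injective = cong swapᵃᵇ ; image? = λ h → yes (swapᵃᵇ h , refl) })
  λ h → swapᵃᵇ h , refl

solves-swapᵇᶜ : ∀ {N s t} → Solves N s t → Solves N (swapᵇᶜ s) (swapᵇᶜ t)
solves-swapᵇᶜ = symmetry
  (record { to = swapᵇᶜ ; to-line = swapᵇᶜ-line
          ; to-size = λ {h} → trans (swapᵇᶜ-size h) ; from-size = λ {h} → trans (sym (swapᵇᶜ-size h))
          ; injective = cong swapᵇᶜ ; image? = λ h → yes (swapᵇᶜ h , refl) })
  λ h → swapᵇᶜ h , refl

-- Translation onto the subtriangle `i ≤ a`, `j ≤ b`, `k ≤ c`. With a single nonzero offset, what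
-- lies outside is a band along one side.
shift : ∀ i j k {M N} → i + j + k + M ≡ N → Embedding M N
shift i j k {M} {N} sum = record
  { to        = sh
  ; to-line   = sh-line
  ; to-size   = λ {h} ∣h∣ → trans (sh-size h) (trans (cong (λ m → i + j + k + m) ∣h∣) sum)
  ; from-size = λ {h} ∣h∣ → +-cancelˡ-≡ (i + j + k) _ _ (trans (sym (sh-size h)) (trans ∣h∣ (sym sum)))
  ; injective = λ {g} {h} eq → cong₃ (+-cancelˡ-≡ i _ _ (cong Cell.a eq))
                  (+-cancelˡ-≡ j _ _ (cong Cell.b eq)) (+-cancelˡ-≡ k _ _ (cong Cell.c eq))
  ; image?    = λ h → map′
      (λ (i≤a , j≤b , k≤c) → cell (Cell.a h ∸ i) (Cell.b h ∸ j) (Cell.c h ∸ k) ,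
        cong₃ (m+[n∸m]≡n i≤a) (m+[n∸m]≡n j≤b) (m+[n∸m]≡n k≤c))
      (λ { (cell a b c , refl) → m≤m+n i a , m≤m+n j b , m≤m+n k c })
      (i ≤? Cell.a h ×-dec j ≤? Cell.b h ×-dec k ≤? Cell.c h)
  }
  where
  sh : Cell → Cell
  sh (cell a b c) = cell (i + a) (j + b) (k + c)

  cong₃ : ∀ {a a′ b b′ c c′} → a ≡ a′ → b ≡ b′ → c ≡ c′ → cell a b c ≡ cell a′ b′ c′
  cong₃ refl refl refl = refl

  sh-size : ∀ h → ∣ sh h ∣ ≡ i + j + k + ∣ h ∣
  sh-size (cell a b c) = solve 6 (λ i j k a b c →
    i :+ a :+ (j :+ b) :+ (k :+ c) := i :+ j :+ k :+ (a :+ b :+ c)) refl i j k a b c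
    where open +-*-Solver

  sh-line : ∀ {p q r} → Line p q r → Line (sh p) (sh q) (sh r)
  sh-line (ab a b c) rewrite +-suc i (suc a) | +-suc i a | +-suc j (suc b) | +-suc j b = ab _ _ _
  sh-line (ba a b c) rewrite +-suc i (suc a) | +-suc i a | +-suc j (suc b) | +-suc j b = ba _ _ _
  sh-line (ac a b c) rewrite +-suc i (suc a) | +-suc i a | +-suc k (suc c) | +-suc k c = ac _ _ _
  sh-line (ca a b c) rewrite +-suc i (suc a) | +-suc i a | +-suc k (suc c) | +-suc k c = ca _ _ _
  sh-line (bc a b c) rewrite +-suc j (suc b) | +-suc j b | +-suc k (suc c) | +-suc k c = bc _ _ _
  sh-line (cb a b c) rewrite +-suc j (suc b) | +-suc j b | +-suc k (suc c) | +-suc k c = cb _ _ _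

-- Explicit plays, verified by evaluation

infixr 5 _▸_

data Play : Set where
  ∎   : Play
  _▸_ : ∀ {p q r} → Line p q r → Play → Play

after : (p q r : Cell) → Pegs → Pegs
after p q r P h =
  if does (h ≟ᶜ r) then true else if does (h ≟ᶜ q) then false else if does (h ≟ᶜ p) then false else P h

all< : ℕ → (ℕ → Bool) → Bool
all< zero    f = true
all< (suc n) f = f n ∧ all< n f

all<-sound : ∀ n f → T (all< n f) → ∀ {m} → m < n → T (f m)
all<-sound (suc n) f ok {m} m<1+n with Equivalence.to T-∧ ok | m≤n⇒m<n∨m≡n m<1+n
... | _  , ok′ | inj₁ (s≤s m<n) = all<-sound n f ok′ m<n
... | fn , _   | inj₂ refl      = fn

allCells : ℕ → Pegs → Bool
allCells N f = all< (suc N) λ a → all< (suc N ∸ a) λ b → f (cell a b (N ∸ a ∸ b))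

allCells-sound : ∀ N f → T (allCells N f) → ∀ h → ∣ h ∣ ≡ N → T (f h)
allCells-sound N f ok (cell a b c) refl =
  subst (λ z → T (f (cell a b z))) c≡
    (all<-sound (suc (a + b + c) ∸ a) _
      (all<-sound (suc (a + b + c)) _ ok (s≤s (≤-trans (m≤m+n a b) (m≤m+n _ c))))
      (subst (b <_) (sym 1+N∸a≡) (s≤s (m≤m+n b c))))
  where
  1+N∸a≡ : suc (a + b + c) ∸ a ≡ suc (b + c)
  1+N∸a≡ = trans (cong (_∸ a) (trans (cong suc (+-assoc a b c)) (sym (+-suc a (b + c)))))
                 (m+n∸m≡n a (suc (b + c)))
  c≡ : a + b + c ∸ a ∸ b ≡ c
  c≡ = trans (∸-+-assoc (a + b + c) a b) (m+n∸m≡n (a + b) c)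

_≡ᵇᵒ_ : Bool → Bool → Bool
true  ≡ᵇᵒ q = q
false ≡ᵇᵒ q = not q

≡ᵇᵒ-sound : ∀ p q → T (p ≡ᵇᵒ q) → p ≡ q
≡ᵇᵒ-sound true  true  _ = refl
≡ᵇᵒ-sound false false _ = refl

-- Boolean-valued, so that for a concrete play `T (valid ...)` normalises to the unit type and its
-- proof can be written `_`.
valid : ℕ → Play → Pegs → Pegs → Bool
valid N ∎ P Q = allCells N λ h → P h ≡ᵇᵒ Q h
valid N (_▸_ {p} {q} {r} _ π) P Q =
  (∣ p ∣ ≡ᵇ N) ∧ P p ∧ P q ∧ not (P r) ∧ valid N π (after p q r P) Q

reach : ∀ {N} π {P Q} → T (valid N π P Q) → Reach N P Q
reach {N} ∎ {P} {Q} ok = done λ h ∣h∣ → ≡ᵇᵒ-sound (P h) (Q h) (allCells-sound N (λ h → P h ≡ᵇᵒ Q h) ok h ∣h∣)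
reach {N} (_▸_ {p} {q} {r} ℓ π) {P} {Q} ok =
  let p≡N , ok₁ = Equivalence.to (T-∧ {∣ p ∣ ≡ᵇ N}) ok
      Pp  , ok₂ = Equivalence.to (T-∧ {P p}) ok₁
      Pq  , ok₃ = Equivalence.to (T-∧ {P q}) ok₂
      ¬Pr , ok₄ = Equivalence.to (T-∧ {not (P r)}) ok₃
      p≢q , p≢r , q≢r = line-distinct ℓ
  in next
    (record
      { line = ℓ ; p-size = ≡ᵇ⇒≡ ∣ p ∣ N p≡N
      ; p-before = Equivalence.to T-≡ Pp
      ; q-before = Equivalence.to T-≡ Pq
      ; r-before = Equivalence.to T-not-≡ ¬Pr
      ; p-after = after-p p≢q p≢r ; q-after = after-q q≢r ; r-after = after-r
      ; unchanged = λ h _ → after-other h })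
    (reach π ok₄)
  where
  after-r : after p q r P r ≡ true
  after-r rewrite dec-true (r ≟ᶜ r) refl = refl
  after-q : q ≢ r → after p q r P q ≡ false
  after-q q≢r rewrite dec-false (q ≟ᶜ r) q≢r | dec-true (q ≟ᶜ q) refl = refl
  after-p : p ≢ q → p ≢ r → after p q r P p ≡ false
  after-p p≢q p≢r rewrite dec-false (p ≟ᶜ r) p≢r | dec-false (p ≟ᶜ q) p≢q | dec-true (p ≟ᶜ p) refl = refl
  after-other : ∀ h → h ≢ p → h ≢ q → h ≢ r → after p q r P h ≡ P h
  after-other h h≢p h≢q h≢r
    rewrite dec-false (h ≟ᶜ r) h≢r | dec-false (h ≟ᶜ q) h≢q | dec-false (h ≟ᶜ p) h≢p = refl

-- Clearing the three bottom rows

outsideᵃ : ∀ {i M N} {eq : i + 0 + 0 + M ≡ N} a b c → Outside (shift i 0 0 eq) (cell a b c) → a < i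
outsideᵃ a b c out = ≰⇒> λ i≤a → out (cell _ b c) (cong (λ z → cell z b c) (m+[n∸m]≡n i≤a))

outsideᵇ : ∀ {j M N} {eq : 0 + j + 0 + M ≡ N} a b c → Outside (shift 0 j 0 eq) (cell a b c) → b < j
outsideᵇ a b c out = ≰⇒> λ j≤b → out (cell a _ c) (cong (λ z → cell a z c) (m+[n∸m]≡n j≤b))

outsideᶜ : ∀ {k M N} {eq : 0 + 0 + k + M ≡ N} a b c → Outside (shift 0 0 k eq) (cell a b c) → c < k
outsideᶜ a b c out = ≰⇒> λ k≤c → out (cell a b _) (cong (cell a b) (m+[n∸m]≡n k≤c))

-- With a fixed sum, one small coordinate forces the other two to be large together. This turns
-- `Outside` into a distance bound, under which two strips can be compared by cases.
beyond : ∀ {i m M n} → n < i → n + m ≡ i + M → M < m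
beyond n<i eq = ≰⇒> λ m≤M → <-irrefl eq (+-mono-<-≤ n<i m≤M)

beyondᵃ : ∀ {i M N} a b c → i + 0 + 0 + M ≡ N → a + b + c ≡ N → a < i → M < b + c
beyondᵃ {i} {M} a b c eq ∣h∣ a<i = beyond a<i (trans (sym (+-assoc a b c)) (trans ∣h∣
  (trans (sym eq) (cong (_+ M) (trans (+-identityʳ (i + 0)) (+-identityʳ i))))))

beyondᵇ : ∀ {j M N} a b c → 0 + j + 0 + M ≡ N → a + b + c ≡ N → b < j → M < a + c
beyondᵇ {j} {M} a b c eq ∣h∣ b<j = beyond b<j (trans
  (solve 3 (λ a b c → b :+ (a :+ c) := a :+ b :+ c) refl a b c)
  (trans ∣h∣ (trans (sym eq) (cong (_+ M) (+-identityʳ j)))))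
  where open +-*-Solver

-- What is left after a corner subtriangle has been reduced to one peg near the end of its side.
strip : Fin 3 → Pegs
strip x (cell a b 0) = true
strip x (cell a b 1) = true
strip x (cell a b 2) = true
strip x (cell a b 3) = a ≡ᵇ toℕ x
strip x (cell a b _) = false

strip₂ : Fin 3 → Pegs
strip₂ x (cell a 0 c)             = false
strip₂ x (cell a 1 c)             = false
strip₂ x (cell a (suc (suc b)) c) = strip x (cell a b c)

-- The two columns `b = 0` and `b = 1` contain each colour twice, so the invariant allows them to
-- vanish with everything else restored; six jumps remove their six pegs.
open-window : Reach 4 (λ (cell a b c) → c <ᵇ 3) (λ (cell a b c) → (c <ᵇ 3) ∧ (1 <ᵇ b))
open-window = reach (
    ac 1 0 1 ▸ ba 0 0 2 ▸ ca 1 0 1 ▸ ac 0 2 0 ▸ ab 1 0 1 ▸ ab 2 0 0 ▸ ∎) _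

-- The extra peg has `a ≤ 2`, so a window with `a ≥ 3` sees only the three full rows.
strip-far : ∀ x i a b c → strip x (cell (3 + i + a) b c) ≡ (c <ᵇ 3)
strip-far x i a b 0 = refl
strip-far x i a b 1 = refl
strip-far x i a b 2 = refl
strip-far zero             i a b 3 = refl
strip-far (suc zero)       i a b 3 = refl
strip-far (suc (suc zero)) i a b 3 = refl
strip-far x i a b (suc (suc (suc (suc c)))) = refl

strip→strip₂ : ∀ k x → Reach (7 + k) (strip x) (strip₂ x)
strip→strip₂ k x = embed (shift (3 + k) 0 0 sum) open-window
  (λ (cell a b c) _ → strip-far x k a b c)
  (λ (cell a b c) _ → inside a b c)
  (λ (cell a b c) ∣h∣ out → outside a b c
    (beyondᵃ a b c sum ∣h∣ (outsideᵃ {eq = sum} a b c out)))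
  where
  sum : 3 + k + 0 + 0 + 4 ≡ 7 + k
  sum = solve 1 (λ k → con 3 :+ k :+ con 0 :+ con 0 :+ con 4 := con 7 :+ k) refl k
    where open +-*-Solver
  inside : ∀ a b c → strip₂ x (cell (3 + k + a) b c) ≡ (c <ᵇ 3) ∧ (1 <ᵇ b)
  inside a 0 0 = refl
  inside a 0 1 = refl
  inside a 0 2 = refl
  inside a 0 (suc (suc (suc c))) = refl
  inside a 1 0 = refl
  inside a 1 1 = refl
  inside a 1 2 = refl
  inside a 1 (suc (suc (suc c))) = refl
  inside a (suc (suc b)) c = trans (strip-far x k a b c) (sym (∧-true (c <ᵇ 3)))
    where
    ∧-true : ∀ p → p ∧ true ≡ p
    ∧-true true  = refl
    ∧-true false = refl
  outside : ∀ a b c → 4 < b + c → strip x (cell a b c) ≡ strip₂ x (cell a b c)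
  outside a 0 0 ()
  outside a 0 1 (s≤s ())
  outside a 0 2 (s≤s (s≤s ()))
  outside a 0 3 (s≤s (s≤s (s≤s ())))
  outside a 0 (suc (suc (suc (suc c)))) _ = refl
  outside a 1 0 (s≤s ())
  outside a 1 1 (s≤s (s≤s ()))
  outside a 1 2 (s≤s (s≤s (s≤s ())))
  outside a 1 3 (s≤s (s≤s (s≤s (s≤s ()))))
  outside a 1 (suc (suc (suc (suc c)))) _ = refl
  outside a (suc (suc b)) 0 _ = refl
  outside a (suc (suc b)) 1 _ = refl
  outside a (suc (suc b)) 2 _ = refl
  outside a (suc (suc b)) 3 _ = refl
  outside a (suc (suc b)) (suc (suc (suc (suc c)))) _ = refl

-- The columns are dropped at the end `b = 0`, away from the extra peg. What remains is the shorter
-- strip translated in `b` alone, so the last peg keeps its `a` and `c`.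
widen : ∀ k x {a b c} → Reach (5 + k) (strip x) (single (cell a b c)) →
        Reach (7 + k) (strip x) (single (cell a (2 + b) c))
widen k x r = reach-trans (strip→strip₂ k x)
  (embed-single (shift 0 2 0 refl) r (λ _ _ → refl)
    λ (cell a b c) _ out → outside a b c (outsideᵇ {eq = refl {x = 7 + k}} a b c out))
  where
  outside : ∀ a b c → b < 2 → strip₂ x (cell a b c) ≡ false
  outside a 0 c _ = refl
  outside a 1 c _ = refl
  outside a (suc (suc b)) c (s≤s (s≤s ()))

-- Serves when the last peg is wanted on the side `a = 0`, at the end where the extra peg stands.
-- The colour forces `z` to be `- x` modulo 3. There are two base lengths because `widen` adds two
-- columns.
near : ∀ k x → ∃ λ b → ∃ λ z → z ≤ 2 × Reach (5 + k) (strip x) (single (cell 0 b z))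
near 0 zero = 5 , 0 , z≤n , reach (
    ac 1 1 1 ▸ ba 0 1 2 ▸ ac 1 2 0 ▸ ab 3 0 0 ▸ ac 2 0 1 ▸ cb 2 0 1 ▸ bc 2 1 0 ▸ ba 0 3 0 ▸
    ba 0 0 3 ▸ bc 1 1 1 ▸ cb 2 0 1 ▸ ac 1 2 0 ▸ cb 1 1 1 ▸ ac 0 3 0 ▸ cb 0 3 0 ▸ ∎) _
near 0 (suc zero) = 3 , 2 , s≤s (s≤s z≤n) , reach (
    ac 2 0 1 ▸ ac 0 2 1 ▸ cb 2 0 1 ▸ ac 2 1 0 ▸ ba 2 1 0 ▸ ab 3 0 0 ▸ ac 1 2 0 ▸ ac 0 1 2 ▸
    ca 0 2 1 ▸ bc 0 2 1 ▸ cb 0 1 2 ▸ bc 1 2 0 ▸ ac 0 2 1 ▸ cb 0 2 1 ▸ bc 0 3 0 ▸ ∎) _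
near 0 (suc (suc zero)) = 4 , 1 , s≤s z≤n , reach (
    ac 1 0 2 ▸ bc 3 0 0 ▸ ab 3 0 0 ▸ ac 2 0 1 ▸ bc 0 2 1 ▸ ab 0 1 2 ▸ bc 2 1 0 ▸ ba 0 3 0 ▸
    ca 1 0 2 ▸ ab 1 0 2 ▸ ca 0 2 1 ▸ ab 1 2 0 ▸ bc 1 2 0 ▸ ac 0 2 1 ▸ cb 0 2 1 ▸ ∎) _
near 1 zero = 6 , 0 , z≤n , reach (
    ac 3 0 1 ▸ bc 4 0 0 ▸ ac 1 2 1 ▸ bc 2 2 0 ▸ ba 0 3 1 ▸ bc 2 1 1 ▸ ca 0 3 1 ▸ ac 2 0 2 ▸
    ab 4 0 0 ▸ ba 0 4 0 ▸ ab 1 3 0 ▸ cb 2 0 2 ▸ ab 1 1 2 ▸ ba 0 2 2 ▸ ca 1 2 1 ▸ ac 2 2 0 ▸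
    cb 2 2 0 ▸ ab 0 4 0 ▸ ∎) _
near 1 (suc zero) = 4 , 2 , s≤s (s≤s z≤n) , reach (
    bc 2 1 1 ▸ ab 2 0 2 ▸ bc 3 1 0 ▸ ba 1 3 0 ▸ ca 1 2 1 ▸ ba 0 2 2 ▸ bc 4 0 0 ▸ ab 4 0 0 ▸
    bc 0 4 0 ▸ ab 1 1 2 ▸ ac 3 0 1 ▸ ba 0 2 2 ▸ ab 1 0 3 ▸ bc 3 1 0 ▸ ca 1 2 1 ▸ cb 3 1 0 ▸
    ab 2 2 0 ▸ ac 0 4 0 ▸ ∎) _
near 1 (suc (suc zero)) = 5 , 1 , s≤s z≤n , reach (
    ac 3 0 1 ▸ ab 1 0 3 ▸ ac 2 1 1 ▸ ba 1 1 2 ▸ bc 2 2 0 ▸ ba 0 4 0 ▸ cb 2 1 1 ▸ ab 1 3 0 ▸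
    bc 0 3 1 ▸ ac 2 2 0 ▸ ca 1 2 1 ▸ bc 1 3 0 ▸ ba 2 1 1 ▸ ab 4 0 0 ▸ bc 4 0 0 ▸ ab 2 0 2 ▸
    ab 0 2 2 ▸ cb 0 3 1 ▸ ∎) _
near (suc (suc k)) x = let b , z , z≤2 , r = near k x in 2 + b , z , z≤2 , widen k x r

-- Serves when the last peg is wanted on the outer row. The cell in the same column `a` as the extra
-- peg, three rows below it, has the same colour, so the invariant permits it.
bottom : ∀ k x → ∃ λ b → Reach (5 + k) (strip x) (single (cell (toℕ x) b 0))
bottom 0 zero = 5 , reach (
    ac 1 1 1 ▸ ba 0 1 2 ▸ ac 1 2 0 ▸ ab 3 0 0 ▸ ac 2 0 1 ▸ cb 2 0 1 ▸ bc 2 1 0 ▸ ba 0 3 0 ▸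
    ba 0 0 3 ▸ bc 1 1 1 ▸ cb 2 0 1 ▸ ac 1 2 0 ▸ cb 1 1 1 ▸ ac 0 3 0 ▸ cb 0 3 0 ▸ ∎) _
bottom 0 (suc zero) = 4 , reach (
    bc 2 0 1 ▸ ab 2 0 1 ▸ bc 2 1 0 ▸ ca 1 1 1 ▸ ba 0 2 1 ▸ ba 0 1 2 ▸ ca 2 0 1 ▸ ba 0 3 0 ▸
    bc 2 0 1 ▸ ac 3 0 0 ▸ ca 2 0 1 ▸ bc 3 0 0 ▸ ca 3 0 0 ▸ ab 3 0 0 ▸ ab 1 2 0 ▸ ∎) _
bottom 0 (suc (suc zero)) = 3 , reach (
    ac 0 2 1 ▸ cb 2 0 1 ▸ ac 1 2 0 ▸ ba 1 2 0 ▸ bc 0 1 2 ▸ bc 0 3 0 ▸ bc 1 1 1 ▸ ca 0 1 2 ▸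
    ac 2 0 1 ▸ cb 2 0 1 ▸ ac 1 2 0 ▸ ba 0 1 2 ▸ ab 3 0 0 ▸ ca 2 1 0 ▸ ab 2 1 0 ▸ ∎) _
bottom 1 zero = 6 , reach (
    ac 1 2 1 ▸ ab 2 0 2 ▸ ba 1 1 2 ▸ bc 0 2 2 ▸ ac 0 4 0 ▸ bc 0 3 1 ▸ cb 0 2 2 ▸ ac 1 3 0 ▸
    ac 4 0 0 ▸ ba 0 4 0 ▸ ba 0 2 2 ▸ ca 1 2 1 ▸ cb 3 1 0 ▸ ab 1 3 0 ▸ ab 3 1 0 ▸ cb 4 0 0 ▸
    ab 2 2 0 ▸ ab 0 4 0 ▸ ∎) _
bottom 1 (suc zero) = 5 , reach (
    bc 3 0 1 ▸ ac 2 0 2 ▸ ac 4 0 0 ▸ ba 1 1 2 ▸ ab 2 0 2 ▸ bc 0 3 1 ▸ ba 0 1 3 ▸ ac 3 1 0 ▸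
    ba 3 1 0 ▸ ab 1 1 2 ▸ ba 1 3 0 ▸ cb 1 3 0 ▸ ba 0 4 0 ▸ cb 2 0 2 ▸ ba 2 2 0 ▸ cb 2 2 0 ▸
    ab 3 1 0 ▸ ab 1 3 0 ▸ ∎) _
bottom 1 (suc (suc zero)) = 4 , reach (
    ac 3 0 1 ▸ bc 4 0 0 ▸ ab 4 0 0 ▸ ba 3 1 0 ▸ ac 2 0 2 ▸ ac 0 3 1 ▸ ba 0 3 1 ▸ ab 1 1 2 ▸
    ba 0 2 2 ▸ ba 1 3 0 ▸ ca 2 2 0 ▸ cb 2 0 2 ▸ ac 1 3 0 ▸ ca 0 3 1 ▸ cb 2 2 0 ▸ ab 3 1 0 ▸
    ab 1 3 0 ▸ ba 0 4 0 ▸ ∎) _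
bottom (suc (suc k)) x = let b , r = bottom k x in 2 + b , widen k x r

-- Sweeping the strip from its left end

-- The vacancy of a notched strip; clearing the two leftmost columns moves it cyclically through
-- these three places, relative to the left end.
holeᵃ holeᶜ : Fin 3 → ℕ
holeᵃ zero             = 1
holeᵃ (suc zero)       = 1
holeᵃ (suc (suc zero)) = 0
holeᶜ zero             = 2
holeᶜ (suc zero)       = 1
holeᶜ (suc (suc zero)) = 2

-- Up to a constant the colour is `a - c` modulo 3, and the three places realise its three values.
-- Two columns of three cells are neutral, so the vacancy must keep its colour while they disappear;
-- measured from the new left end, two columns further on, this is a cyclic shift.
rotate : Fin 3 → Fin 3
rotate zero             = suc zero
rotate (suc zero)       = suc (suc zero)
rotate (suc (suc zero)) = zero

rotate⁻¹ : Fin 3 → Fin 3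
rotate⁻¹ zero             = suc (suc zero)
rotate⁻¹ (suc zero)       = zero
rotate⁻¹ (suc (suc zero)) = suc zero

notched : Fin 3 → Pegs
notched s (cell a b c) = (c <ᵇ 3) ∧ not ((a ≡ᵇ holeᵃ s) ∧ (c ≡ᵇ holeᶜ s))

notched₂ : Fin 3 → Pegs
notched₂ s (cell 0 b c)             = false
notched₂ s (cell 1 b c)             = false
notched₂ s (cell (suc (suc a)) b c) = notched s (cell a b c)

-- Modulo 2 an extra peg and a missing peg of the same colour count alike. The extra peg has colour
-- `x`, up to a constant, and `rotate⁻¹ x` is the place which, moved two columns to the right, has
-- that colour.
enter-window : ∀ x → Reach 5 (strip x) (notched₂ (rotate⁻¹ x))
enter-window zero = reach (
    bc 0 1 2 ▸ ac 0 3 0 ▸ bc 0 2 1 ▸ bc 2 0 1 ▸ ba 0 3 0 ▸ cb 0 1 2 ▸ ba 0 1 2 ▸ cb 2 0 1 ▸ ∎) _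
enter-window (suc zero) = reach (
    ac 0 2 1 ▸ ab 1 0 2 ▸ bc 0 1 2 ▸ ac 0 3 0 ▸ ca 0 1 2 ▸ bc 0 2 1 ▸ ca 0 2 1 ▸ ba 0 3 0 ▸ ∎) _
enter-window (suc (suc zero)) = reach (
    bc 1 1 1 ▸ ab 1 1 1 ▸ cb 2 0 1 ▸ bc 0 2 1 ▸ ac 0 3 0 ▸ bc 0 1 2 ▸ ca 0 1 2 ▸ ba 0 3 0 ▸ ∎) _

sweep-window : ∀ s → Reach 5 (notched s) (notched₂ (rotate s))
sweep-window zero = reach (
    bc 0 2 1 ▸ ac 0 3 0 ▸ cb 0 2 1 ▸ ba 0 3 0 ▸ ab 1 1 1 ▸ ba 0 2 1 ▸ ∎) _
sweep-window (suc zero) = reach (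
    bc 2 0 1 ▸ bc 0 2 1 ▸ ca 0 2 1 ▸ bc 2 1 0 ▸ ba 0 3 0 ▸ cb 2 0 1 ▸ ∎) _
sweep-window (suc (suc zero)) = reach (
    ac 0 2 1 ▸ ab 1 0 2 ▸ ba 0 2 1 ▸ bc 2 1 0 ▸ ca 0 2 1 ▸ ba 0 3 0 ▸ ∎) _

strip-beyond : ∀ x a b c → 5 < a + c → strip x (cell a b c) ≡ (c <ᵇ 3)
strip-beyond x a b 0 _ = refl
strip-beyond x a b 1 _ = refl
strip-beyond x a b 2 _ = refl
strip-beyond x 0 b 3 (s≤s (s≤s (s≤s ())))
strip-beyond x 1 b 3 (s≤s (s≤s (s≤s (s≤s ()))))
strip-beyond x 2 b 3 (s≤s (s≤s (s≤s (s≤s (s≤s ())))))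
strip-beyond x (suc (suc (suc a))) b 3 _ = strip-far x 0 a b 3
strip-beyond x a b (suc (suc (suc (suc c)))) _ = refl

notched-far : ∀ s a b c → notched s (cell (2 + a) b c) ≡ (c <ᵇ 3)
notched-far s a b (suc (suc (suc c))) = refl
notched-far zero             a b 0 = refl
notched-far zero             a b 1 = refl
notched-far zero             a b 2 = refl
notched-far (suc zero)       a b 0 = refl
notched-far (suc zero)       a b 1 = refl
notched-far (suc zero)       a b 2 = refl
notched-far (suc (suc zero)) a b 0 = refl
notched-far (suc (suc zero)) a b 1 = refl
notched-far (suc (suc zero)) a b 2 = refl

-- The notch has `a ≤ 1`, or `a ≤ 3` after two columns are gone; beyond the window both are out of
-- sight.
4≤a : ∀ a c → c ≤ 2 → 5 < a + c → 4 ≤ a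
4≤a a c c≤2 5<a+c = +-cancelʳ-≤ 2 4 a (≤-trans 5<a+c (+-monoʳ-≤ a c≤2))

notched-beyond : ∀ s a b c → 5 < a + c → notched s (cell a b c) ≡ (c <ᵇ 3)
notched-beyond s a b (suc (suc (suc c))) _ = refl
notched-beyond s a b 0 lt with s≤s (s≤s p) ← 4≤a a 0 z≤n lt = notched-far s _ b 0
notched-beyond s a b 1 lt with s≤s (s≤s p) ← 4≤a a 1 (s≤s z≤n) lt = notched-far s _ b 1
notched-beyond s a b 2 lt with s≤s (s≤s p) ← 4≤a a 2 (s≤s (s≤s z≤n)) lt = notched-far s _ b 2

notched₂-beyond : ∀ s a b c → 5 < a + c → notched₂ s (cell a b c) ≡ (c <ᵇ 3)
notched₂-beyond s 0 b (suc (suc (suc c))) _ = refl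
notched₂-beyond s 1 b (suc (suc (suc c))) _ = refl
notched₂-beyond s (suc (suc a)) b (suc (suc (suc c))) _ = refl
notched₂-beyond s a b 0 lt with s≤s (s≤s (s≤s (s≤s p))) ← 4≤a a 0 z≤n lt = notched-far s _ b 0
notched₂-beyond s a b 1 lt with s≤s (s≤s (s≤s (s≤s p))) ← 4≤a a 1 (s≤s z≤n) lt = notched-far s _ b 1
notched₂-beyond s a b 2 lt with s≤s (s≤s (s≤s (s≤s p))) ← 4≤a a 2 (s≤s (s≤s z≤n)) lt = notched-far s _ b 2

sumᵇ : ∀ k → 0 + k + 0 + 5 ≡ 5 + k
sumᵇ k = solve 1 (λ k → con 0 :+ k :+ con 0 :+ con 5 := con 5 :+ k) refl k
  where open +-*-Solver

-- The window `k ≤ b` is the left end of the strip. The patterns depend on `a` and `c` only, so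
-- translating in `b` does not change them, and beyond the window both are three full rows.
enter-step : ∀ k x → Reach (5 + k) (strip x) (notched₂ (rotate⁻¹ x))
enter-step k x = embed (shift 0 k 0 (sumᵇ k)) (enter-window x)
  (λ (cell a b c) _ → stripᵇ a b c) (λ (cell a b c) _ → notched₂ᵇ a b c)
  λ (cell a b c) ∣h∣ out →
    let far = beyondᵇ a b c (sumᵇ k) ∣h∣ (outsideᵇ {eq = sumᵇ k} a b c out)
    in trans (strip-beyond x a b c far) (sym (notched₂-beyond (rotate⁻¹ x) a b c far))
  where
  stripᵇ : ∀ a b c → strip x (cell a (k + b) c) ≡ strip x (cell a b c)
  stripᵇ a b 0 = refl
  stripᵇ a b 1 = refl
  stripᵇ a b 2 = refl
  stripᵇ a b 3 = refl
  stripᵇ a b (suc (suc (suc (suc c)))) = refl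
  notched₂ᵇ : ∀ a b c → notched₂ (rotate⁻¹ x) (cell a (k + b) c) ≡ notched₂ (rotate⁻¹ x) (cell a b c)
  notched₂ᵇ 0 b c = refl
  notched₂ᵇ 1 b c = refl
  notched₂ᵇ (suc (suc a)) b c = refl

sweep-step : ∀ k s → Reach (5 + k) (notched s) (notched₂ (rotate s))
sweep-step k s = embed (shift 0 k 0 (sumᵇ k)) (sweep-window s)
  (λ _ _ → refl) (λ (cell a b c) _ → notched₂ᵇ a b c)
  λ (cell a b c) ∣h∣ out →
    let far = beyondᵇ a b c (sumᵇ k) ∣h∣ (outsideᵇ {eq = sumᵇ k} a b c out)
    in trans (notched-beyond s a b c far) (sym (notched₂-beyond (rotate s) a b c far))
  where
  notched₂ᵇ : ∀ a b c → notched₂ (rotate s) (cell a (k + b) c) ≡ notched₂ (rotate s) (cell a b c)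
  notched₂ᵇ 0 b c = refl
  notched₂ᵇ 1 b c = refl
  notched₂ᵇ (suc (suc a)) b c = refl

notched₂-single : ∀ N s {a b c} → Reach N (notched s) (single (cell a b c)) →
                  Reach (2 + N) (notched₂ s) (single (cell (2 + a) b c))
notched₂-single N s r = embed-single (shift 2 0 0 refl) r (λ _ _ → refl)
  λ (cell a b c) _ out → outside a b c (outsideᵃ {eq = refl {x = 2 + N}} a b c out)
  where
  outside : ∀ a b c → a < 2 → notched₂ s (cell a b c) ≡ false
  outside 0 b c _ = refl
  outside 1 b c _ = refl
  outside (suc (suc a)) b c (s≤s (s≤s ()))

-- The vacancy only cycles while columns disappear, so two base lengths, each with all three
-- vacancies, suffice. The base plays end on the side `b = 0`, and the translation in `a` keeps them
-- there.
sweep : ∀ k s → ∃ λ a → ∃ λ z → z ≤ 2 × Reach (4 + k) (notched s) (single (cell a 0 z))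
sweep 0 zero = 3 , 1 , s≤s z≤n , reach (
    ac 1 0 1 ▸ bc 0 1 1 ▸ ac 0 2 0 ▸ cb 0 1 1 ▸ bc 0 2 0 ▸ ab 2 0 0 ▸ ba 1 1 0 ▸ ac 1 1 0 ▸
    ba 0 0 2 ▸ ca 1 0 1 ▸ ∎) _
sweep 0 (suc zero) = 2 , 2 , s≤s (s≤s z≤n) , reach (
    ac 1 0 1 ▸ cb 1 0 1 ▸ bc 0 1 1 ▸ ac 0 2 0 ▸ cb 0 1 1 ▸ bc 0 2 0 ▸ ab 2 0 0 ▸ ba 1 1 0 ▸
    ac 1 1 0 ▸ ba 0 0 2 ▸ ∎) _
sweep 0 (suc (suc zero)) = 4 , 0 , z≤n , reach (
    ac 1 0 1 ▸ ac 0 2 0 ▸ ba 0 0 2 ▸ ca 1 0 1 ▸ bc 0 2 0 ▸ ab 1 0 1 ▸ ab 2 0 0 ▸ ba 1 1 0 ▸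
    ca 0 2 0 ▸ ba 2 0 0 ▸ ∎) _
sweep 1 zero = 5 , 0 , z≤n , reach (
    bc 2 0 1 ▸ ac 2 1 0 ▸ ba 2 1 0 ▸ ab 3 0 0 ▸ ba 0 3 0 ▸ ab 1 2 0 ▸ ac 1 0 2 ▸ bc 0 2 1 ▸
    bc 1 2 0 ▸ ca 0 2 1 ▸ bc 2 0 1 ▸ ca 1 0 2 ▸ ca 3 0 0 ▸ ∎) _
sweep 1 (suc zero) = 4 , 1 , s≤s z≤n , reach (
    ac 1 1 1 ▸ bc 2 1 0 ▸ ba 0 3 0 ▸ ab 1 2 0 ▸ cb 0 3 0 ▸ ba 0 3 0 ▸ ca 1 1 1 ▸ ac 2 0 1 ▸
    ab 3 0 0 ▸ ba 2 1 0 ▸ ac 2 1 0 ▸ ba 1 0 2 ▸ ca 2 0 1 ▸ ∎) _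
sweep 1 (suc (suc zero)) = 3 , 2 , s≤s (s≤s z≤n) , reach (
    ac 2 0 1 ▸ ba 2 0 1 ▸ ac 3 0 0 ▸ ca 2 0 1 ▸ bc 1 1 1 ▸ ba 3 0 0 ▸ bc 0 3 0 ▸ ba 1 2 0 ▸
    ac 3 0 0 ▸ ab 1 0 2 ▸ ba 0 1 2 ▸ ca 1 1 1 ▸ bc 3 0 0 ▸ ∎) _
sweep (suc (suc k)) s = let a , z , z≤2 , r = sweep k (rotate s) in
  2 + a , z , z≤2 , reach-trans (sweep-step (1 + k) s) (notched₂-single (4 + k) (rotate s) r)

-- Counterpart of `near`: the last peg ends up on the side `b = 0`, at the end opposite to the extra
-- peg.
far : ∀ k x → ∃ λ a → ∃ λ z → z ≤ 2 × Reach (6 + k) (strip x) (single (cell a 0 z))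
far k x = let a , z , z≤2 , r = sweep k (rotate⁻¹ x) in
  2 + a , z , z≤2 , reach-trans (enter-step (1 + k) x) (notched₂-single (4 + k) (rotate⁻¹ x) r)

-- Small boards and induction

holds : ∀ {A : Set} (a? : Dec A) → T (does a?) → A
holds (yes a) _ = a

-- Condition (B) in symmetric form. As `x + y` is `2a + b`, colour 0 means that `a` and `b` are
-- congruent; then `n ≡ 1`, that is `a + b + c ≡ 0`, means that `c` is congruent to them.
Balanced : Cell → Set
Balanced (cell a b c) = a % 3 ≡ b % 3 × b % 3 ≡ c % 3

balanced? : Decidable Balanced
balanced? (cell a b c) = (a % 3 ≟ b % 3) ×-dec (b % 3 ≟ c % 3)

Corner : Cell → Set
Corner (cell a b c) = c ≡ 0 × (a ≤ 2 ⊎ b ≤ 2)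

corner? : Decidable Corner
corner? (cell a b c) = (c ≟ 0) ×-dec ((a ≤? 2) ⊎-dec (b ≤? 2))

EndsIn : (Cell → Set) → ℕ → Cell → Set
EndsIn G N s = ∃ λ t → G t × Solves N s t

-- Vacancy, final peg and play; vacancies are listed up to the reflection swapᵃᵇ.
Table : Set
Table = List (Cell × Cell × Play)

correct : ∀ {G : Cell → Set} → Decidable G → ℕ → Cell × Cell × Play → Bool
correct G? N (s , t , π) = does (G? t) ∧ valid N π (vacancy s) (single t)

treats : Cell → Cell × Cell × Play → Bool
treats h (s , _) = does (h ≟ᶜ s) ∨ does (h ≟ᶜ swapᵃᵇ s)

covers : Table → Cell → Bool
covers table h = does (balanced? h) ∨ any (treats h) table

-- Completeness of a table is itself evaluated over all cells. The hypothesis that `G` respects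
-- `swapᵃᵇ` lets one entry serve a mirror pair of vacancies.
tabulated : ∀ {G : Cell → Set} (G? : Decidable G) → (∀ {t} → G t → G (swapᵃᵇ t)) → ∀ N table →
  T (all (correct G? N) table) → T (allCells N (covers table)) →
  ∀ s → ∣ s ∣ ≡ N → ¬ Balanced s → EndsIn G N s
tabulated {G} G? G-swap N table ok complete s ∣s∣ ¬bal
  with Equivalence.to (T-∨ {does (balanced? s)}) (allCells-sound N (covers table) complete s ∣s∣)
... | inj₁ bal   = ⊥-elim (¬bal (holds (balanced? s) bal))
... | inj₂ found = let (s′ , t , π) , ∈table , same = find (any⁻ (treats s) table found)
                       Gt , played = Equivalence.to (T-∧ {does (G? t)}) (lookup (all⁺ (correct G? N) table ok) ∈table)
                   in match s′ t (holds (G? t) Gt) (reach π played)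
                        (Equivalence.to (T-∨ {does (s ≟ᶜ s′)}) same)
  where
  match : ∀ s′ t → G t → Solves N s′ t →
          T (does (s ≟ᶜ s′)) ⊎ T (does (s ≟ᶜ swapᵃᵇ s′)) → EndsIn G N s
  match s′ t Gt r (inj₁ same) =
    t , Gt , subst (λ u → Solves N u t) (sym (holds (s ≟ᶜ s′) same)) r
  match s′ t Gt r (inj₂ same) =
    swapᵃᵇ t , G-swap Gt ,
    subst (λ u → Solves N u (swapᵃᵇ t)) (sym (holds (s ≟ᶜ swapᵃᵇ s′) same)) (solves-swapᵃᵇ r)

table₄ : Table
table₄ =
  (cell 0 1 2 , cell 1 0 2 ,
    bc 0 1 0 ▸ ab 0 0 1 ▸ ca 0 0 1 ▸ ac 1 0 0 ▸ bc 0 0 1 ▸ ca 0 0 1 ▸ ba 1 0 0 ▸ ac 1 0 0 ▸ ∎) ∷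
  (cell 0 2 1 , cell 1 2 0 ,
    cb 0 0 1 ▸ bc 0 1 0 ▸ ab 0 1 0 ▸ ac 0 0 1 ▸ cb 0 0 1 ▸ bc 0 1 0 ▸ ca 0 1 0 ▸ ab 1 0 0 ▸ ∎) ∷
  (cell 1 2 0 , cell 0 2 1 ,
    ab 1 0 0 ▸ ba 0 1 0 ▸ cb 0 1 0 ▸ ac 0 1 0 ▸ cb 0 0 1 ▸ ac 0 0 1 ▸ bc 0 1 0 ▸ cb 0 0 1 ▸ ∎) ∷
  []

table₅ : Table
table₅ =
  (cell 0 0 4 , cell 2 2 0 ,
    ac 0 0 2 ▸ ba 0 0 2 ▸ ac 1 1 0 ▸ ba 1 1 0 ▸ ac 1 0 1 ▸ ca 0 0 2 ▸ bc 0 2 0 ▸ ca 0 1 1 ▸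
    cb 2 0 0 ▸ ab 1 1 0 ▸ ca 0 2 0 ▸ ba 1 1 0 ▸ ab 2 0 0 ▸ ∎) ∷
  (cell 0 1 3 , cell 2 0 2 ,
    bc 0 1 1 ▸ ac 0 2 0 ▸ ba 0 2 0 ▸ ab 1 1 0 ▸ cb 0 1 1 ▸ ab 0 0 2 ▸ ca 0 0 2 ▸ ac 1 0 1 ▸
    cb 0 2 0 ▸ ba 0 2 0 ▸ bc 2 0 0 ▸ ca 1 0 1 ▸ ac 2 0 0 ▸ ∎) ∷
  (cell 0 2 2 , cell 0 2 2 ,
    bc 0 2 0 ▸ cb 0 1 1 ▸ ab 0 0 2 ▸ ca 0 0 2 ▸ ac 1 0 1 ▸ bc 2 0 0 ▸ cb 0 2 0 ▸ ba 0 2 0 ▸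
    ab 1 1 0 ▸ bc 1 1 0 ▸ ca 1 0 1 ▸ ac 2 0 0 ▸ ab 0 0 2 ▸ ∎) ∷
  (cell 0 3 1 , cell 2 2 0 ,
    cb 0 1 1 ▸ ab 0 0 2 ▸ ac 2 0 0 ▸ ca 1 0 1 ▸ bc 2 0 0 ▸ ba 0 2 0 ▸ bc 0 1 1 ▸ cb 0 0 2 ▸
    ca 2 0 0 ▸ ab 1 1 0 ▸ ca 0 2 0 ▸ ba 1 1 0 ▸ ab 2 0 0 ▸ ∎) ∷
  (cell 0 4 0 , cell 2 0 2 ,
    ab 0 2 0 ▸ ca 0 2 0 ▸ ab 1 1 0 ▸ bc 0 2 0 ▸ cb 0 1 1 ▸ ab 0 0 2 ▸ ca 0 0 2 ▸ ac 1 0 1 ▸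
    cb 0 2 0 ▸ ba 0 2 0 ▸ bc 2 0 0 ▸ ca 1 0 1 ▸ ac 2 0 0 ▸ ∎) ∷
  (cell 1 1 2 , cell 2 2 0 ,
    bc 1 1 0 ▸ ab 1 1 0 ▸ ab 1 0 1 ▸ ca 0 2 0 ▸ ba 1 1 0 ▸ cb 0 0 2 ▸ bc 0 1 1 ▸ ca 1 0 1 ▸
    ca 0 1 1 ▸ ac 2 0 0 ▸ cb 2 0 0 ▸ ab 1 1 0 ▸ ba 0 2 0 ▸ ∎) ∷
  (cell 1 2 1 , cell 2 0 2 ,
    cb 1 0 1 ▸ ac 1 0 1 ▸ bc 2 0 0 ▸ ab 2 0 0 ▸ ba 1 1 0 ▸ ca 1 0 1 ▸ ba 0 1 1 ▸ cb 0 1 1 ▸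
    bc 0 2 0 ▸ ac 1 1 0 ▸ ba 0 0 2 ▸ ac 1 0 1 ▸ ca 0 0 2 ▸ ∎) ∷
  (cell 1 3 0 , cell 0 2 2 ,
    ab 1 1 0 ▸ cb 2 0 0 ▸ ca 0 0 2 ▸ ac 1 0 1 ▸ ba 0 0 2 ▸ ca 1 0 1 ▸ ba 1 1 0 ▸ ba 0 1 1 ▸
    ac 1 1 0 ▸ ac 2 0 0 ▸ ab 0 0 2 ▸ cb 0 1 1 ▸ bc 0 2 0 ▸ ∎) ∷
  (cell 2 2 0 , cell 2 2 0 ,
    ab 2 0 0 ▸ ca 2 0 0 ▸ ba 0 0 2 ▸ ca 1 0 1 ▸ ba 1 1 0 ▸ bc 0 2 0 ▸ ca 0 2 0 ▸ cb 0 0 2 ▸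
    ab 1 0 1 ▸ ab 1 1 0 ▸ ca 0 2 0 ▸ ba 1 1 0 ▸ ab 2 0 0 ▸ ∎) ∷
  []

table₆ : Table
table₆ =
  (cell 0 0 5 , cell 4 1 0 ,
    ac 0 0 3 ▸ ac 2 0 1 ▸ ba 2 0 1 ▸ ac 3 0 0 ▸ ca 2 0 1 ▸ ba 1 0 2 ▸ ca 0 1 2 ▸ bc 0 1 2 ▸
    bc 0 3 0 ▸ ca 3 0 0 ▸ bc 1 2 0 ▸ ab 1 2 0 ▸ cb 0 0 3 ▸ cb 0 2 1 ▸ ab 0 1 2 ▸ cb 0 3 0 ▸
    ba 0 3 0 ▸ ab 3 0 0 ▸ ba 2 1 0 ▸ ∎) ∷
  (cell 0 1 4 , cell 2 3 0 ,
    bc 0 1 2 ▸ bc 0 3 0 ▸ ab 0 3 0 ▸ ab 2 1 0 ▸ cb 0 0 3 ▸ bc 0 1 2 ▸ ac 0 2 1 ▸ ab 1 0 2 ▸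
    ca 1 0 2 ▸ cb 0 1 2 ▸ bc 1 0 2 ▸ ac 2 0 1 ▸ ca 1 0 2 ▸ cb 3 0 0 ▸ ba 2 1 0 ▸ ca 0 3 0 ▸
    ab 3 0 0 ▸ ab 1 2 0 ▸ ba 0 3 0 ▸ ∎) ∷
  (cell 0 2 3 , cell 3 2 0 ,
    cb 0 0 3 ▸ bc 0 1 2 ▸ ab 0 1 2 ▸ ac 1 2 0 ▸ ab 3 0 0 ▸ ba 0 2 1 ▸ cb 1 1 1 ▸ bc 2 1 0 ▸
    ab 1 0 2 ▸ bc 1 1 1 ▸ ca 1 0 2 ▸ ca 0 1 2 ▸ ab 1 0 2 ▸ ba 0 1 2 ▸ ba 0 3 0 ▸ ab 1 2 0 ▸
    ab 2 0 1 ▸ cb 2 1 0 ▸ ba 1 2 0 ▸ ∎) ∷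
  (cell 0 3 2 , cell 4 1 0 ,
    ab 0 1 2 ▸ ac 1 2 0 ▸ ab 3 0 0 ▸ ba 0 1 2 ▸ cb 2 0 1 ▸ ac 1 2 0 ▸ ca 0 2 1 ▸ cb 3 0 0 ▸
    cb 0 0 3 ▸ cb 1 0 2 ▸ ba 1 1 1 ▸ ca 0 2 1 ▸ bc 0 3 0 ▸ ac 1 2 0 ▸ ba 0 1 2 ▸ ba 1 2 0 ▸
    ab 2 0 1 ▸ cb 2 1 0 ▸ ba 2 1 0 ▸ ∎) ∷
  (cell 0 4 1 , cell 5 0 0 ,
    ab 0 2 1 ▸ ca 0 2 1 ▸ ac 1 2 0 ▸ ab 3 0 0 ▸ ba 2 1 0 ▸ ba 0 3 0 ▸ cb 2 0 1 ▸ ac 2 0 1 ▸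
    ab 1 1 1 ▸ ca 1 0 2 ▸ ba 0 2 1 ▸ bc 2 1 0 ▸ cb 1 1 1 ▸ cb 0 0 3 ▸ cb 0 2 1 ▸ ba 0 2 1 ▸
    ab 1 0 2 ▸ ca 1 2 0 ▸ ba 3 0 0 ▸ ∎) ∷
  (cell 0 5 0 , cell 3 2 0 ,
    ab 0 3 0 ▸ ab 2 1 0 ▸ ca 1 2 0 ▸ ab 1 0 2 ▸ ca 1 0 2 ▸ ba 0 0 3 ▸ ac 1 0 2 ▸ ac 3 0 0 ▸
    ba 0 2 1 ▸ ab 1 2 0 ▸ cb 0 0 3 ▸ ba 0 3 0 ▸ ba 0 1 2 ▸ ab 1 0 2 ▸ bc 2 1 0 ▸ ca 0 2 1 ▸
    bc 2 0 1 ▸ ca 1 0 2 ▸ cb 3 0 0 ▸ ∎) ∷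
  (cell 1 1 3 , cell 4 1 0 ,
    ac 1 1 1 ▸ ba 1 1 1 ▸ ac 2 1 0 ▸ ca 0 2 1 ▸ ab 1 0 2 ▸ ca 1 0 2 ▸ bc 2 1 0 ▸ ba 0 3 0 ▸
    ab 1 2 0 ▸ cb 1 1 1 ▸ ab 1 0 2 ▸ cb 0 3 0 ▸ cb 0 0 3 ▸ ca 0 2 1 ▸ ba 1 1 1 ▸ ba 0 3 0 ▸
    ac 3 0 0 ▸ cb 3 0 0 ▸ ba 2 1 0 ▸ ∎) ∷
  (cell 1 2 2 , cell 2 3 0 ,
    ac 1 2 0 ▸ ab 3 0 0 ▸ cb 2 0 1 ▸ ac 2 0 1 ▸ bc 2 1 0 ▸ cb 2 0 1 ▸ ca 0 0 3 ▸ bc 3 0 0 ▸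
    ac 1 0 2 ▸ ba 1 1 1 ▸ ba 0 3 0 ▸ cb 1 1 1 ▸ bc 0 0 3 ▸ ca 0 0 3 ▸ ba 0 2 1 ▸ bc 2 1 0 ▸
    cb 2 0 1 ▸ ab 1 1 1 ▸ ca 0 3 0 ▸ ∎) ∷
  (cell 1 3 1 , cell 3 2 0 ,
    ab 1 1 1 ▸ cb 2 0 1 ▸ ba 0 1 2 ▸ ac 1 2 0 ▸ ab 3 0 0 ▸ ba 2 1 0 ▸ ca 0 2 1 ▸ ab 1 0 2 ▸
    ca 0 1 2 ▸ cb 2 1 0 ▸ ba 1 2 0 ▸ ca 0 0 3 ▸ bc 0 3 0 ▸ ba 0 1 2 ▸ cb 2 0 1 ▸ ba 1 1 1 ▸
    bc 3 0 0 ▸ ca 3 0 0 ▸ ab 3 0 0 ▸ ∎) ∷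
  (cell 1 4 0 , cell 4 1 0 ,
    ab 1 2 0 ▸ cb 2 1 0 ▸ ca 0 2 1 ▸ bc 2 1 0 ▸ cb 0 0 3 ▸ cb 2 0 1 ▸ ba 0 0 3 ▸ ba 0 3 0 ▸
    cb 0 3 0 ▸ cb 3 0 0 ▸ bc 2 1 0 ▸ ca 1 0 2 ▸ ac 2 0 1 ▸ cb 2 0 1 ▸ ac 1 2 0 ▸ cb 1 2 0 ▸
    ba 0 3 0 ▸ ab 3 0 0 ▸ ba 2 1 0 ▸ ∎) ∷
  (cell 2 2 1 , cell 4 1 0 ,
    ab 2 0 1 ▸ ba 1 1 1 ▸ cb 2 0 1 ▸ bc 2 1 0 ▸ ca 0 2 1 ▸ cb 0 0 3 ▸ bc 0 1 2 ▸ cb 1 0 2 ▸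
    ba 0 3 0 ▸ bc 2 0 1 ▸ ca 2 0 1 ▸ ab 2 0 1 ▸ ac 0 2 1 ▸ cb 0 1 2 ▸ cb 0 3 0 ▸ ab 1 2 0 ▸
    ba 0 3 0 ▸ ab 3 0 0 ▸ ba 2 1 0 ▸ ∎) ∷
  (cell 2 3 0 , cell 5 0 0 ,
    cb 2 1 0 ▸ ab 2 0 1 ▸ ba 0 1 2 ▸ ac 1 2 0 ▸ cb 2 0 1 ▸ bc 2 1 0 ▸ ca 0 2 1 ▸ bc 1 2 0 ▸
    cb 2 1 0 ▸ ca 0 1 2 ▸ ab 3 0 0 ▸ ba 2 1 0 ▸ bc 0 3 0 ▸ ca 0 0 3 ▸ cb 2 0 1 ▸ ba 0 1 2 ▸
    ab 1 0 2 ▸ ca 1 2 0 ▸ ba 3 0 0 ▸ ∎) ∷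
  []

table₇ : Table
table₇ =
  (cell 0 1 5 , cell 2 4 0 ,
    bc 0 1 3 ▸ ac 0 2 2 ▸ ab 2 0 2 ▸ ba 1 1 2 ▸ ac 2 2 0 ▸ ab 4 0 0 ▸ cb 1 0 3 ▸ ab 3 0 1 ▸
    ac 1 0 3 ▸ ab 1 1 2 ▸ cb 0 1 3 ▸ ca 0 0 4 ▸ bc 1 1 2 ▸ ac 2 2 0 ▸ ac 0 1 3 ▸ bc 0 2 2 ▸
    ac 1 3 0 ▸ cb 0 1 3 ▸ ca 0 3 1 ▸ ba 1 3 0 ▸ bc 2 1 1 ▸ ba 0 3 1 ▸ cb 2 0 2 ▸ cb 2 2 0 ▸
    ab 1 3 0 ▸ ba 0 4 0 ▸ ∎) ∷
  (cell 0 2 4 , cell 4 2 0 ,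
    ac 0 2 2 ▸ cb 2 0 2 ▸ bc 2 1 1 ▸ ba 0 3 1 ▸ bc 2 2 0 ▸ cb 0 3 1 ▸ cb 0 1 3 ▸ ca 0 0 4 ▸
    ca 0 3 1 ▸ ac 1 0 3 ▸ bc 3 0 1 ▸ ab 3 0 1 ▸ ca 1 1 2 ▸ ac 2 0 2 ▸ ba 2 1 1 ▸ ca 1 0 3 ▸
    ab 2 2 0 ▸ cb 3 0 1 ▸ bc 0 4 0 ▸ ba 1 3 0 ▸ ac 3 1 0 ▸ ab 1 1 2 ▸ ba 0 2 2 ▸ ca 2 2 0 ▸
    ba 3 1 0 ▸ ab 4 0 0 ▸ ∎) ∷
  (cell 0 4 2 , cell 2 4 0 ,
    ab 0 2 2 ▸ cb 2 0 2 ▸ ab 1 1 2 ▸ bc 3 1 0 ▸ ab 3 0 1 ▸ ca 3 0 1 ▸ ba 1 3 0 ▸ ca 0 4 0 ▸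
    ac 4 0 0 ▸ cb 0 2 2 ▸ ab 1 3 0 ▸ cb 1 2 1 ▸ bc 0 3 1 ▸ cb 0 0 4 ▸ bc 0 1 3 ▸ ca 0 1 3 ▸
    ab 2 0 2 ▸ ab 3 1 0 ▸ bc 2 0 2 ▸ bc 3 1 0 ▸ bc 1 3 0 ▸ ca 1 0 3 ▸ cb 3 0 1 ▸ ab 1 2 1 ▸
    cb 1 3 0 ▸ ba 0 4 0 ▸ ∎) ∷
  (cell 0 5 1 , cell 4 2 0 ,
    cb 0 3 1 ▸ ab 0 1 3 ▸ bc 2 1 1 ▸ ab 1 0 3 ▸ ca 0 1 3 ▸ bc 0 1 3 ▸ cb 0 0 4 ▸ ac 2 2 0 ▸
    bc 1 1 2 ▸ bc 0 4 0 ▸ bc 1 3 0 ▸ ac 3 0 1 ▸ ab 1 0 3 ▸ ca 1 2 1 ▸ ab 4 0 0 ▸ ac 2 1 1 ▸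
    ca 1 0 3 ▸ ba 0 2 2 ▸ cb 2 1 1 ▸ ba 0 0 4 ▸ ca 2 0 2 ▸ ba 2 1 1 ▸ ba 3 1 0 ▸ cb 4 0 0 ▸
    ab 3 1 0 ▸ ba 2 2 0 ▸ ∎) ∷
  (cell 1 2 3 , cell 5 1 0 ,
    ac 1 2 1 ▸ cb 3 0 1 ▸ ac 3 0 1 ▸ bc 2 2 0 ▸ cb 2 1 1 ▸ ca 0 1 3 ▸ bc 0 1 3 ▸ bc 0 3 1 ▸
    cb 0 0 4 ▸ bc 3 1 0 ▸ ba 1 2 1 ▸ ba 0 4 0 ▸ ca 0 2 2 ▸ ab 1 0 3 ▸ ba 0 1 3 ▸ bc 4 0 0 ▸
    ca 2 1 1 ▸ ba 1 1 2 ▸ ca 1 0 3 ▸ cb 3 1 0 ▸ ba 2 2 0 ▸ ab 3 1 0 ▸ ca 3 0 1 ▸ ac 4 0 0 ▸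
    cb 4 0 0 ▸ ba 3 1 0 ▸ ∎) ∷
  (cell 1 3 2 , cell 4 2 0 ,
    ac 1 3 0 ▸ ab 2 1 1 ▸ cb 3 0 1 ▸ ba 2 1 1 ▸ ca 1 0 3 ▸ ab 3 0 1 ▸ ba 1 3 0 ▸ ca 0 4 0 ▸
    cb 2 1 1 ▸ ab 1 2 1 ▸ ca 3 0 1 ▸ ab 1 3 0 ▸ ac 4 0 0 ▸ bc 0 4 0 ▸ ca 0 2 2 ▸ ba 1 1 2 ▸
    cb 0 0 4 ▸ bc 0 1 3 ▸ bc 1 3 0 ▸ ab 2 0 2 ▸ ca 0 1 3 ▸ cb 2 1 1 ▸ ba 0 2 2 ▸ cb 2 2 0 ▸
    ab 3 1 0 ▸ ba 2 2 0 ▸ ∎) ∷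
  (cell 1 5 0 , cell 2 4 0 ,
    ab 1 3 0 ▸ ab 3 1 0 ▸ cb 4 0 0 ▸ ca 2 1 1 ▸ bc 2 1 1 ▸ ca 0 2 2 ▸ bc 4 0 0 ▸ ac 1 2 1 ▸
    ca 0 3 1 ▸ cb 2 0 2 ▸ bc 2 1 1 ▸ ba 0 4 0 ▸ ac 2 0 2 ▸ ac 4 0 0 ▸ ca 1 0 3 ▸ cb 0 0 4 ▸
    ab 0 1 3 ▸ ac 2 0 2 ▸ ab 1 3 0 ▸ bc 1 3 0 ▸ ca 0 3 1 ▸ bc 0 3 1 ▸ bc 0 1 3 ▸ ca 0 1 3 ▸
    cb 2 0 2 ▸ cb 2 2 0 ▸ ∎) ∷
  (cell 2 3 1 , cell 5 1 0 ,
    cb 2 1 1 ▸ ca 0 2 2 ▸ ac 1 2 1 ▸ ab 2 0 2 ▸ ac 3 1 0 ▸ bc 2 1 1 ▸ cb 0 0 4 ▸ ba 3 1 0 ▸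
    ca 0 2 2 ▸ ac 4 0 0 ▸ cb 3 0 1 ▸ ca 2 2 0 ▸ ba 1 3 0 ▸ ba 4 0 0 ▸ ca 1 1 2 ▸ ba 0 2 2 ▸
    bc 0 4 0 ▸ ca 1 0 3 ▸ cb 0 3 1 ▸ ba 0 3 1 ▸ bc 2 1 1 ▸ ca 2 1 1 ▸ ca 3 0 1 ▸ ac 4 0 0 ▸
    cb 4 0 0 ▸ ba 3 1 0 ▸ ∎) ∷
  (cell 2 4 0 , cell 4 2 0 ,
    ab 2 2 0 ▸ ca 2 2 0 ▸ ab 3 0 1 ▸ ca 0 2 2 ▸ ab 1 0 3 ▸ cb 0 0 4 ▸ bc 2 1 1 ▸ ca 0 2 2 ▸
    ab 3 1 0 ▸ cb 2 1 1 ▸ ba 2 2 0 ▸ bc 0 2 2 ▸ ba 0 4 0 ▸ ac 0 3 1 ▸ ca 1 0 3 ▸ ac 2 0 2 ▸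
    bc 0 1 3 ▸ cb 3 1 0 ▸ ba 0 3 1 ▸ ca 0 1 3 ▸ cb 2 0 2 ▸ ab 1 3 0 ▸ cb 2 2 0 ▸ ba 1 3 0 ▸
    ba 3 1 0 ▸ ab 4 0 0 ▸ ∎) ∷
  []

table₈ : Table
table₈ =
  (cell 0 0 7 , cell 5 2 0 ,
    ac 0 0 5 ▸ ba 0 0 5 ▸ ac 1 1 3 ▸ ac 1 0 4 ▸ cb 0 0 5 ▸ bc 0 1 4 ▸ ac 0 3 2 ▸ ca 0 1 4 ▸
    ba 0 3 2 ▸ ac 1 4 0 ▸ ba 1 0 4 ▸ ac 2 0 3 ▸ ca 0 4 1 ▸ ac 0 5 0 ▸ ac 4 0 1 ▸ ac 1 2 2 ▸
    ab 3 2 0 ▸ ba 0 5 0 ▸ ca 1 0 4 ▸ ab 5 0 0 ▸ ba 0 1 4 ▸ bc 5 0 0 ▸ bc 0 4 1 ▸ ab 1 0 4 ▸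
    ba 2 3 0 ▸ ab 3 0 2 ▸ bc 2 2 1 ▸ bc 4 1 0 ▸ bc 3 1 1 ▸ ab 1 1 3 ▸ ba 0 2 3 ▸ ca 1 2 2 ▸
    cb 4 0 1 ▸ ca 3 2 0 ▸ ∎) ∷
  (cell 0 1 6 , cell 6 1 0 ,
    bc 0 1 4 ▸ bc 0 3 2 ▸ ab 0 2 3 ▸ cb 2 0 3 ▸ bc 2 1 2 ▸ ab 2 0 3 ▸ bc 0 5 0 ▸ ac 4 0 1 ▸
    ac 3 1 1 ▸ ba 3 1 1 ▸ ca 3 0 2 ▸ ac 4 1 0 ▸ bc 2 3 0 ▸ cb 3 1 1 ▸ ac 1 3 1 ▸ ab 3 0 2 ▸
    ba 0 3 2 ▸ bc 1 4 0 ▸ ca 1 3 1 ▸ ba 4 1 0 ▸ cb 0 3 2 ▸ bc 3 1 1 ▸ cb 1 1 3 ▸ ac 1 1 3 ▸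
    ca 0 1 4 ▸ ca 0 0 5 ▸ ab 5 0 0 ▸ ba 1 1 3 ▸ cb 2 0 3 ▸ ab 1 1 3 ▸ cb 1 3 1 ▸ ca 0 5 0 ▸
    ba 2 3 0 ▸ ba 4 1 0 ▸ ∎) ∷
  (cell 0 2 5 , cell 7 0 0 ,
    ac 0 2 3 ▸ bc 1 2 2 ▸ ac 1 4 0 ▸ ba 0 4 1 ▸ ab 1 3 1 ▸ ca 0 2 3 ▸ cb 0 0 5 ▸ bc 0 1 4 ▸
    ab 3 2 0 ▸ cb 0 4 1 ▸ ab 5 0 0 ▸ bc 0 5 0 ▸ ab 3 1 1 ▸ ac 1 3 1 ▸ ca 5 0 0 ▸ ba 3 0 2 ▸
    ba 0 3 2 ▸ ab 0 0 5 ▸ bc 0 0 5 ▸ ca 4 0 1 ▸ ac 5 0 0 ▸ ca 0 0 5 ▸ ca 2 0 3 ▸ cb 2 2 1 ▸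
    ca 2 1 2 ▸ ba 2 3 0 ▸ cb 4 0 1 ▸ ba 4 1 0 ▸ bc 1 4 0 ▸ cb 1 3 1 ▸ ba 1 3 1 ▸ ba 3 1 1 ▸
    cb 5 0 0 ▸ ba 5 0 0 ▸ ∎) ∷
  (cell 0 3 4 , cell 5 2 0 ,
    bc 0 3 2 ▸ cb 0 2 3 ▸ ab 0 1 4 ▸ bc 2 1 2 ▸ ab 2 1 2 ▸ bc 4 1 0 ▸ cb 2 0 3 ▸ cb 0 3 2 ▸
    bc 3 2 0 ▸ ca 1 4 0 ▸ ab 1 2 2 ▸ ca 0 0 5 ▸ ca 0 1 4 ▸ ac 1 1 3 ▸ ab 3 0 2 ▸ ba 0 3 2 ▸
    ca 2 2 1 ▸ ba 2 3 0 ▸ ac 5 0 0 ▸ ac 1 0 4 ▸ ba 5 0 0 ▸ ca 4 0 1 ▸ cb 1 0 4 ▸ cb 1 2 2 ▸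
    ab 3 1 1 ▸ ba 1 2 2 ▸ ba 0 4 1 ▸ ac 5 0 0 ▸ ba 0 5 0 ▸ bc 2 3 0 ▸ ba 2 1 2 ▸ ab 3 0 2 ▸
    cb 3 2 0 ▸ ba 3 2 0 ▸ ∎) ∷
  (cell 0 4 3 , cell 6 1 0 ,
    ac 0 4 1 ▸ cb 2 2 1 ▸ ab 2 0 3 ▸ ba 1 1 3 ▸ ca 0 2 3 ▸ ac 1 4 0 ▸ ba 0 3 2 ▸ ab 1 0 4 ▸
    ca 1 0 4 ▸ cb 0 0 5 ▸ ac 4 0 1 ▸ ac 2 0 3 ▸ cb 2 2 1 ▸ ab 3 2 0 ▸ ac 2 1 2 ▸ ab 5 0 0 ▸
    cb 0 3 2 ▸ ba 2 3 0 ▸ ba 0 5 0 ▸ bc 1 0 4 ▸ ca 1 0 4 ▸ ab 1 0 4 ▸ ab 3 2 0 ▸ ac 1 4 0 ▸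
    ba 0 4 1 ▸ ca 0 2 3 ▸ ba 0 3 2 ▸ ba 2 1 2 ▸ cb 4 1 0 ▸ bc 2 3 0 ▸ cb 2 2 1 ▸ ba 2 2 1 ▸
    bc 4 1 0 ▸ ca 4 1 0 ▸ ∎) ∷
  (cell 0 5 2 , cell 7 0 0 ,
    ab 0 3 2 ▸ ac 1 4 0 ▸ ab 3 2 0 ▸ ba 2 3 0 ▸ cb 2 1 2 ▸ ca 0 2 3 ▸ ac 1 2 2 ▸ ba 0 1 4 ▸
    cb 5 0 0 ▸ ab 2 2 1 ▸ ab 0 0 5 ▸ cb 0 1 4 ▸ ab 1 0 4 ▸ ba 0 2 3 ▸ ca 1 2 2 ▸ bc 0 4 1 ▸
    ca 0 0 5 ▸ bc 2 2 1 ▸ ac 2 1 2 ▸ ac 5 0 0 ▸ cb 2 1 2 ▸ ba 2 1 2 ▸ ac 3 0 2 ▸ cb 0 3 2 ▸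
    ba 0 3 2 ▸ ba 0 5 0 ▸ ca 2 0 3 ▸ cb 4 0 1 ▸ ac 3 2 0 ▸ ab 1 2 2 ▸ cb 1 4 0 ▸ ba 1 4 0 ▸
    ba 3 2 0 ▸ ba 5 0 0 ▸ ∎) ∷
  (cell 0 6 1 , cell 2 5 0 ,
    cb 0 4 1 ▸ ab 0 2 3 ▸ ac 1 3 1 ▸ ab 2 1 2 ▸ ac 3 2 0 ▸ ab 4 0 1 ▸ ca 4 0 1 ▸ ca 2 1 2 ▸
    bc 0 5 0 ▸ ba 1 3 1 ▸ ba 3 2 0 ▸ ac 2 2 1 ▸ ba 1 4 0 ▸ cb 2 2 1 ▸ ab 4 1 0 ▸ ca 0 2 3 ▸
    ab 2 3 0 ▸ cb 0 0 5 ▸ ac 5 0 0 ▸ ab 1 3 1 ▸ ac 0 0 5 ▸ ab 3 0 2 ▸ ca 0 3 2 ▸ bc 0 3 2 ▸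
    ac 0 5 0 ▸ bc 0 1 4 ▸ bc 2 1 2 ▸ cb 0 0 5 ▸ ab 1 0 4 ▸ ca 0 2 3 ▸ ac 1 2 2 ▸ cb 1 1 3 ▸
    cb 1 3 1 ▸ ca 0 5 0 ▸ ∎) ∷
  (cell 0 7 0 , cell 6 1 0 ,
    cb 0 5 0 ▸ ab 0 3 2 ▸ ab 2 1 2 ▸ bc 4 1 0 ▸ ab 3 0 2 ▸ ca 2 1 2 ▸ cb 1 2 2 ▸ ba 2 3 0 ▸
    bc 3 1 1 ▸ cb 0 4 1 ▸ ac 5 0 0 ▸ ca 1 4 0 ▸ cb 2 2 1 ▸ ca 0 1 4 ▸ bc 0 1 4 ▸ cb 0 0 5 ▸
    ab 2 3 0 ▸ bc 1 4 0 ▸ ab 3 0 2 ▸ bc 0 5 0 ▸ cb 3 1 1 ▸ ab 4 1 0 ▸ ab 1 0 4 ▸ ca 1 0 4 ▸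
    ba 2 2 1 ▸ ca 3 0 2 ▸ ba 0 3 2 ▸ bc 4 1 0 ▸ ca 0 2 3 ▸ cb 2 2 1 ▸ bc 2 3 0 ▸ ab 3 0 2 ▸
    ba 2 1 2 ▸ ca 4 1 0 ▸ ∎) ∷
  (cell 1 1 5 , cell 5 2 0 ,
    ac 1 1 3 ▸ bc 2 1 2 ▸ ca 0 2 3 ▸ ab 1 0 4 ▸ ac 3 0 2 ▸ bc 5 0 0 ▸ bc 3 1 1 ▸ cb 0 0 5 ▸
    ba 3 2 0 ▸ bc 0 1 4 ▸ ba 0 3 2 ▸ ac 4 0 1 ▸ bc 0 5 0 ▸ ac 3 2 0 ▸ cb 4 0 1 ▸ ac 0 3 2 ▸
    bc 2 3 0 ▸ ab 5 0 0 ▸ ac 0 0 5 ▸ ab 1 2 2 ▸ ba 0 1 4 ▸ ab 1 0 4 ▸ cb 1 1 3 ▸ bc 1 2 2 ▸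
    ca 1 2 2 ▸ cb 3 1 1 ▸ bc 0 3 2 ▸ bc 1 4 0 ▸ cb 0 0 5 ▸ cb 0 2 3 ▸ ca 0 4 1 ▸ ac 3 2 0 ▸
    ba 2 2 1 ▸ ca 3 2 0 ▸ ∎) ∷
  (cell 1 2 4 , cell 6 1 0 ,
    ac 1 2 2 ▸ bc 2 2 1 ▸ ba 0 3 2 ▸ cb 2 2 1 ▸ cb 2 0 3 ▸ ba 0 1 4 ▸ ac 3 2 0 ▸ ac 1 2 2 ▸
    ba 0 2 3 ▸ bc 1 4 0 ▸ ba 3 2 0 ▸ ca 0 0 5 ▸ ca 1 2 2 ▸ cb 0 1 4 ▸ ab 2 0 3 ▸ ac 4 0 1 ▸
    ab 0 0 5 ▸ bc 5 0 0 ▸ bc 2 3 0 ▸ ac 1 2 2 ▸ ac 2 0 3 ▸ bc 0 5 0 ▸ cb 0 2 3 ▸ ab 3 0 2 ▸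
    cb 2 0 3 ▸ ca 2 2 1 ▸ ba 1 2 2 ▸ ab 5 0 0 ▸ bc 3 1 1 ▸ bc 0 3 2 ▸ ba 0 1 4 ▸ ca 2 1 2 ▸
    cb 4 1 0 ▸ ba 4 1 0 ▸ ∎) ∷
  (cell 1 3 3 , cell 7 0 0 ,
    cb 1 1 3 ▸ ac 1 2 2 ▸ ac 3 2 0 ▸ ab 4 0 1 ▸ ba 0 2 3 ▸ bc 1 3 1 ▸ ac 1 4 0 ▸ cb 0 2 3 ▸
    bc 1 1 3 ▸ cb 1 0 4 ▸ cb 3 2 0 ▸ cb 2 2 1 ▸ ab 5 0 0 ▸ ac 3 2 0 ▸ ba 0 3 2 ▸ ac 1 4 0 ▸
    cb 2 0 3 ▸ bc 2 1 2 ▸ cb 0 0 5 ▸ ca 0 4 1 ▸ bc 0 5 0 ▸ ca 0 2 3 ▸ ab 1 0 4 ▸ ba 1 4 0 ▸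
    ac 1 4 0 ▸ cb 3 1 1 ▸ ca 1 2 2 ▸ ca 4 0 1 ▸ ba 0 3 2 ▸ ab 1 2 2 ▸ ac 2 3 0 ▸ ba 1 2 2 ▸
    ba 3 0 2 ▸ ca 5 0 0 ▸ ∎) ∷
  (cell 1 4 2 , cell 5 2 0 ,
    ac 1 4 0 ▸ cb 2 2 1 ▸ cb 2 0 3 ▸ ba 0 1 4 ▸ ac 1 2 2 ▸ bc 0 3 2 ▸ ca 0 0 5 ▸ ab 3 2 0 ▸
    cb 3 0 2 ▸ ca 1 1 3 ▸ ac 3 0 2 ▸ bc 2 3 0 ▸ ca 2 0 3 ▸ ba 3 0 2 ▸ cb 5 0 0 ▸ ba 0 5 0 ▸
    ab 4 1 0 ▸ bc 4 1 0 ▸ ba 0 1 4 ▸ cb 4 0 1 ▸ ac 5 0 0 ▸ ba 1 2 2 ▸ ba 0 4 1 ▸ cb 0 1 4 ▸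
    ca 2 1 2 ▸ ac 2 2 1 ▸ ab 1 4 0 ▸ ab 1 3 1 ▸ ca 0 3 2 ▸ bc 1 4 0 ▸ ba 1 2 2 ▸ ca 2 2 1 ▸
    ab 3 0 2 ▸ ca 3 2 0 ▸ ∎) ∷
  (cell 1 5 1 , cell 6 1 0 ,
    ab 1 3 1 ▸ cb 2 2 1 ▸ ba 0 3 2 ▸ ac 1 4 0 ▸ ca 0 2 3 ▸ ca 0 4 1 ▸ ab 1 2 2 ▸ ac 3 2 0 ▸
    bc 2 3 0 ▸ ba 0 4 1 ▸ cb 3 1 1 ▸ ab 1 0 4 ▸ ba 0 5 0 ▸ ab 5 0 0 ▸ ba 0 1 4 ▸ ba 2 2 1 ▸
    ac 3 2 0 ▸ cb 2 2 1 ▸ bc 1 2 2 ▸ cb 0 0 5 ▸ bc 2 3 0 ▸ cb 4 0 1 ▸ ab 3 1 1 ▸ ca 1 1 3 ▸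
    ba 2 1 2 ▸ ac 4 0 1 ▸ cb 4 0 1 ▸ bc 4 1 0 ▸ ca 0 2 3 ▸ ca 1 0 4 ▸ cb 3 0 2 ▸ ca 2 2 1 ▸
    ba 3 1 1 ▸ ca 4 1 0 ▸ ∎) ∷
  (cell 1 6 0 , cell 1 6 0 ,
    ab 1 4 0 ▸ ca 1 4 0 ▸ cb 2 2 1 ▸ ca 0 2 3 ▸ ac 1 2 2 ▸ ab 3 0 2 ▸ ca 3 0 2 ▸ ac 2 3 0 ▸
    ba 1 3 1 ▸ ab 4 1 0 ▸ cb 2 0 3 ▸ cb 1 2 2 ▸ ca 0 4 1 ▸ ac 1 3 1 ▸ bc 0 4 1 ▸ cb 5 0 0 ▸
    cb 3 1 1 ▸ ca 0 0 5 ▸ ac 3 2 0 ▸ ac 1 4 0 ▸ ac 1 2 2 ▸ ba 0 1 4 ▸ cb 2 0 3 ▸ ba 0 5 0 ▸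
    ac 5 0 0 ▸ ca 0 1 4 ▸ cb 2 1 2 ▸ ba 1 2 2 ▸ ba 0 2 3 ▸ ca 2 2 1 ▸ ba 3 1 1 ▸ cb 5 0 0 ▸
    ab 3 2 0 ▸ ab 1 4 0 ▸ ∎) ∷
  (cell 2 2 3 , cell 5 2 0 ,
    cb 2 0 3 ▸ bc 2 1 2 ▸ bc 2 3 0 ▸ ba 0 4 1 ▸ ca 0 2 3 ▸ bc 1 2 2 ▸ ac 1 4 0 ▸ ac 0 2 3 ▸
    ac 2 0 3 ▸ ba 0 5 0 ▸ cb 2 0 3 ▸ ab 1 1 3 ▸ ab 3 2 0 ▸ cb 1 0 4 ▸ ab 5 0 0 ▸ ca 0 4 1 ▸
    ab 1 3 1 ▸ ac 4 0 1 ▸ cb 0 2 3 ▸ cb 0 4 1 ▸ ba 3 0 2 ▸ ba 0 4 1 ▸ ca 1 3 1 ▸ bc 2 3 0 ▸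
    cb 0 0 5 ▸ ac 3 2 0 ▸ ac 3 0 2 ▸ bc 3 1 1 ▸ ca 0 2 3 ▸ cb 3 0 2 ▸ ca 2 2 1 ▸ ab 3 1 1 ▸
    ca 2 3 0 ▸ ba 3 2 0 ▸ ∎) ∷
  (cell 2 3 2 , cell 0 7 0 ,
    ab 2 1 2 ▸ ac 4 1 0 ▸ ba 4 1 0 ▸ ca 1 2 2 ▸ ab 1 0 4 ▸ ca 0 2 3 ▸ cb 0 0 5 ▸ ba 2 3 0 ▸
    ba 0 5 0 ▸ cb 0 5 0 ▸ bc 1 2 2 ▸ ab 1 2 2 ▸ bc 0 1 4 ▸ ab 5 0 0 ▸ ca 0 1 4 ▸ ac 3 2 0 ▸
    ac 0 5 0 ▸ cb 3 2 0 ▸ cb 0 4 1 ▸ ab 1 1 3 ▸ bc 0 5 0 ▸ cb 4 0 1 ▸ ba 3 2 0 ▸ ca 1 0 4 ▸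
    bc 1 1 3 ▸ ac 4 0 1 ▸ ac 2 0 3 ▸ cb 2 0 3 ▸ ac 3 2 0 ▸ ac 1 2 2 ▸ cb 1 1 3 ▸ cb 1 3 1 ▸
    ab 0 4 1 ▸ cb 0 5 0 ▸ ∎) ∷
  (cell 2 4 1 , cell 1 6 0 ,
    cb 2 2 1 ▸ cb 2 0 3 ▸ ba 0 1 4 ▸ ac 1 2 2 ▸ bc 2 3 0 ▸ ca 0 2 3 ▸ cb 1 0 4 ▸ ab 2 3 0 ▸
    ac 1 1 3 ▸ ab 3 0 2 ▸ ab 4 1 0 ▸ ac 5 0 0 ▸ bc 2 1 2 ▸ ac 2 2 1 ▸ ca 1 2 2 ▸ cb 0 0 5 ▸
    bc 0 3 2 ▸ bc 3 1 1 ▸ cb 3 0 2 ▸ ca 4 0 1 ▸ ab 4 0 1 ▸ bc 4 1 0 ▸ ab 2 1 2 ▸ ba 1 2 2 ▸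
    ba 0 0 5 ▸ ca 0 3 2 ▸ ba 0 4 1 ▸ cb 2 0 3 ▸ ab 1 2 2 ▸ bc 2 3 0 ▸ ba 0 5 0 ▸ cb 2 2 1 ▸
    ca 1 4 0 ▸ ab 1 4 0 ▸ ∎) ∷
  (cell 2 5 0 , cell 5 2 0 ,
    cb 2 3 0 ▸ ab 2 1 2 ▸ ac 4 1 0 ▸ ba 4 1 0 ▸ ca 3 1 1 ▸ ba 1 2 2 ▸ ba 0 4 1 ▸ ba 2 3 0 ▸
    ca 0 3 2 ▸ ab 5 0 0 ▸ cb 0 1 4 ▸ ac 1 3 1 ▸ ba 0 5 0 ▸ ca 1 1 3 ▸ ab 3 1 1 ▸ ba 0 1 4 ▸
    ab 1 0 4 ▸ ca 1 0 4 ▸ ac 0 2 3 ▸ ab 2 0 3 ▸ ba 1 1 3 ▸ bc 0 3 2 ▸ bc 0 1 4 ▸ ab 3 2 0 ▸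
    cb 0 0 5 ▸ bc 2 3 0 ▸ ac 4 0 1 ▸ ab 2 0 3 ▸ bc 2 1 2 ▸ ab 1 0 4 ▸ ca 0 2 3 ▸ ca 2 2 1 ▸
    bc 3 2 0 ▸ ca 3 2 0 ▸ ∎) ∷
  (cell 3 3 1 , cell 5 2 0 ,
    ab 3 1 1 ▸ ca 2 2 1 ▸ ca 0 2 3 ▸ bc 1 2 2 ▸ ac 1 4 0 ▸ ab 1 1 3 ▸ ba 1 2 2 ▸ ba 0 4 1 ▸
    ab 3 2 0 ▸ ca 1 1 3 ▸ cb 0 4 1 ▸ ba 0 1 4 ▸ cb 0 0 5 ▸ ca 3 1 1 ▸ ba 2 3 0 ▸ cb 2 0 3 ▸
    ac 2 0 3 ▸ cb 5 0 0 ▸ ba 0 5 0 ▸ ab 1 3 1 ▸ ba 0 4 1 ▸ ac 5 0 0 ▸ bc 2 3 0 ▸ ca 1 3 1 ▸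
    ac 2 3 0 ▸ ab 4 1 0 ▸ bc 4 1 0 ▸ bc 2 1 2 ▸ ca 1 0 4 ▸ ab 1 0 4 ▸ ca 0 2 3 ▸ ca 2 2 1 ▸
    ab 3 0 2 ▸ ca 3 2 0 ▸ ∎) ∷
  (cell 3 4 0 , cell 0 7 0 ,
    ab 3 2 0 ▸ ca 3 2 0 ▸ ca 1 2 2 ▸ ba 2 3 0 ▸ ca 0 5 0 ▸ bc 0 5 0 ▸ ab 1 3 1 ▸ cb 2 0 3 ▸
    ca 2 2 1 ▸ ab 3 0 2 ▸ ca 0 4 1 ▸ cb 0 2 3 ▸ ac 5 0 0 ▸ ca 1 3 1 ▸ bc 4 1 0 ▸ cb 1 0 4 ▸
    ba 1 4 0 ▸ ac 1 4 0 ▸ ab 2 1 2 ▸ ac 1 3 1 ▸ ca 4 0 1 ▸ ab 4 0 1 ▸ ab 4 1 0 ▸ bc 4 1 0 ▸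
    cb 0 0 5 ▸ cb 3 0 2 ▸ ab 2 1 2 ▸ ca 0 2 3 ▸ cb 1 4 0 ▸ bc 0 3 2 ▸ cb 2 2 1 ▸ ca 0 3 2 ▸
    cb 2 3 0 ▸ ab 0 5 0 ▸ ∎) ∷
  []

-- Induction on the size of the board

Anywhere : Cell → Set
Anywhere _ = ⊤

corner-swap : ∀ {t} → Corner t → Corner (swapᵃᵇ t)
corner-swap (c≡0 , inj₁ a≤2) = c≡0 , inj₂ a≤2
corner-swap (c≡0 , inj₂ b≤2) = c≡0 , inj₁ b≤2

-- On the boards of size 3 and 4 the place of the last peg is left free: the induction starts at
-- size 5 and builds nothing on them.
solve₄ : ∀ s → ∣ s ∣ ≡ 3 → ¬ Balanced s → EndsIn Anywhere 3 s
solve₄ = tabulated (λ _ → yes tt) _ 3 table₄ _ _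

solve₅ : ∀ s → ∣ s ∣ ≡ 4 → ¬ Balanced s → EndsIn Anywhere 4 s
solve₅ = tabulated (λ _ → yes tt) _ 4 table₅ _ _

solve₆ : ∀ s → ∣ s ∣ ≡ 5 → ¬ Balanced s → EndsIn Corner 5 s
solve₆ = tabulated corner? corner-swap 5 table₆ _ _

solve₇ : ∀ s → ∣ s ∣ ≡ 6 → ¬ Balanced s → EndsIn Corner 6 s
solve₇ = tabulated corner? corner-swap 6 table₇ _ _

solve₈ : ∀ s → ∣ s ∣ ≡ 7 → ¬ Balanced s → EndsIn Corner 7 s
solve₈ = tabulated corner? corner-swap 7 table₈ _ _

reach-peg : ∀ {N P Q} → Reach N P Q → (∃ λ h → ∣ h ∣ ≡ N × P h ≡ true) → ∃ λ h → ∣ h ∣ ≡ N × Q h ≡ true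
reach-peg (done P≈Q) (h , ∣h∣ , Ph) = h , ∣h∣ , trans (sym (P≈Q h ∣h∣)) Ph
reach-peg (next s r) _              = reach-peg r (Step.r s , Step.r-size s , Step.r-after s)

vacancy-peg : ∀ N s → 0 < N → ∃ λ h → ∣ h ∣ ≡ N × vacancy s h ≡ true
vacancy-peg (suc N) (cell zero b c)    _ = cell (suc N) 0 0 , trans (+-identityʳ _) (+-identityʳ _) ,
  cong not (dec-false (cell (suc N) 0 0 ≟ᶜ cell zero b c) λ ())
vacancy-peg (suc N) (cell (suc a) b c) _ = cell 0 0 (suc N) , refl ,
  cong not (dec-false (cell 0 0 (suc N) ≟ᶜ cell (suc a) b c) λ ())

-- `Solves` by itself would allow `t` off the board, with `single t` empty there. But every jump
-- leaves a peg at its target, so a board with a peg never becomes empty.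
solves-size : ∀ {N s t} → 0 < N → Solves N s t → ∣ t ∣ ≡ N
solves-size {N} {s} {t} 0<N r =
  let h , ∣h∣ , th = reach-peg r (vacancy-peg N s 0<N)
  in trans (cong ∣_∣ (sym (holds (h ≟ᶜ t) (subst T (sym th) tt)))) ∣h∣

-- The subtriangle `3 ≤ c` is a copy of the smaller board. Its last peg, on the side of the copy
-- facing the three full rows, becomes the extra peg of `strip x`.
lift : ∀ {N a b c} x {y} → 0 < N → Solves N (cell a b c) (cell (toℕ x) y 0) →
       Reach (3 + N) (vacancy (cell a b (3 + c))) (strip x)
lift {N} {a} {b} {c} x {y} 0<N r = embed (shift 0 0 3 refl) r (λ _ _ → refl) inside
  λ (cell a′ b′ c′) _ out → outside a′ b′ c′ (outsideᶜ {eq = refl {x = 3 + N}} a′ b′ c′ out)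
  where
  t : Cell
  t = cell (toℕ x) y 0
  inside : ∀ h → ∣ h ∣ ≡ N → strip x (Embedding.to (shift 0 0 3 {N} refl) h) ≡ single t h
  inside (cell a′ b′ (suc c′)) _   = refl
  inside (cell a′ b′ zero)     ∣h∣ with a′ ≟ toℕ x
  ... | yes refl = trans (dec-true (a′ ≟ a′) refl)
    (sym (dec-true (cell a′ b′ 0 ≟ᶜ t) (cong (λ z → cell a′ z 0) b′≡y)))
    where
    -- `strip` tests only `a`, while `single` tests the whole cell; the two agree because `t` lies
    -- on the board, so its `b` is determined by `a` and `c = 0`.
    b′≡y : b′ ≡ y
    b′≡y = +-cancelˡ-≡ a′ _ _ (+-cancelʳ-≡ 0 _ _ (trans ∣h∣ (sym (solves-size 0<N r))))
  ... | no a′≢x  = trans (dec-false (a′ ≟ toℕ x) a′≢x)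
    (sym (dec-false (cell a′ b′ 0 ≟ᶜ t) (a′≢x ∘ cong Cell.a)))
  outside : ∀ a′ b′ c′ → c′ < 3 → vacancy (cell a b (3 + c)) (cell a′ b′ c′) ≡ strip x (cell a′ b′ c′)
  outside a′ b′ 0 _ = refl
  outside a′ b′ 1 _ = refl
  outside a′ b′ 2 _ = refl
  outside a′ b′ (suc (suc (suc c′))) (s≤s (s≤s (s≤s ())))

-- `strip` knows the extra peg only at its left end, so a peg at the right end is reflected, and the
-- vacancy with it.
corner-left : ∀ {N a b c} → EndsIn Corner N (cell a b c) →
  (∃ λ x → ∃ λ y → Solves N (cell a b c) (cell (toℕ {3} x) y 0)) ⊎
  (∃ λ x → ∃ λ y → Solves N (cell b a c) (cell (toℕ {3} x) y 0))
corner-left {N} {a} {b} {c} (cell x y .0 , (refl , inj₁ x≤2) , r) = inj₁ (fromℕ< (s≤s x≤2) , y ,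
  subst (λ z → Solves N (cell a b c) (cell z y 0)) (sym (toℕ-fromℕ< (s≤s x≤2))) r)
corner-left {N} {a} {b} {c} (cell x y .0 , (refl , inj₂ y≤2) , r) = inj₂ (fromℕ< (s≤s y≤2) , x ,
  subst (λ z → Solves N (cell b a c) (cell z x 0)) (sym (toℕ-fromℕ< (s≤s y≤2))) (solves-swapᵃᵇ r))

extendᶜ : ∀ k {a b c} → EndsIn Corner (5 + k) (cell a b c) → EndsIn Corner (8 + k) (cell a b (3 + c))
extendᶜ k {a} {b} {c} ends with corner-left ends
... | inj₁ (x , y , r) = let b′ , r′ = bottom (3 + k) x in
  _ , (refl , inj₁ (toℕ≤pred[n] x)) , reach-trans (lift x z<s r) r′
... | inj₂ (x , y , r) = let b′ , r′ = bottom (3 + k) x in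
  _ , (refl , inj₂ (toℕ≤pred[n] x)) , solves-swapᵃᵇ (reach-trans (lift x z<s r) r′)

-- Here the full rows lie along the side `b = 0`, and only one end of them meets the side `c = 0`
-- where the last peg has to be. An extra peg at the opposite end calls for `far`, one at that end
-- for `near`.
extendᵇ : ∀ k {a b c} → EndsIn Corner (5 + k) (cell a c b) → EndsIn Corner (8 + k) (cell a (3 + b) c)
extendᵇ k {a} {b} {c} ends with corner-left ends
... | inj₁ (x , y , r) = let a′ , z , z≤2 , r′ = far (2 + k) x in
  _ , (refl , inj₂ z≤2) , solves-swapᵇᶜ (reach-trans (lift x z<s r) r′)
... | inj₂ (x , y , r) = let b′ , z , z≤2 , r′ = near (3 + k) x in
  _ , (refl , inj₂ z≤2) , solves-swapᵇᶜ (solves-swapᵃᵇ (reach-trans (lift x z<s r) r′))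

extendᵃ : ∀ k {a b c} → EndsIn Corner (5 + k) (cell b c a) → EndsIn Corner (8 + k) (cell (3 + a) b c)
extendᵃ k ends = let t , corner , r = extendᵇ k ends in swapᵃᵇ t , corner-swap corner , solves-swapᵃᵇ r

solve-large : ∀ k s → ∣ s ∣ ≡ 5 + k → ¬ Balanced s → EndsIn Corner (5 + k) s
solve-large 0 = solve₆
solve-large 1 = solve₇
solve-large 2 = solve₈
solve-large (suc (suc (suc k))) (cell a b c) ∣s∣ ¬bal with 3 ≤? c | 3 ≤? b | 3 ≤? a
-- `(3 + c′) % 3` computes to `c′ % 3`, so `¬bal` applies to the smaller vacancy as it stands.
... | yes 3≤c | _ | _ with c′ , refl ← m≤n⇒∃[o]m+o≡n 3≤c =
  extendᶜ k (solve-large k (cell a b c′) (Embedding.from-size (shift 0 0 3 refl) {cell a b c′} ∣s∣) ¬bal)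
... | _ | yes 3≤b | _ with b′ , refl ← m≤n⇒∃[o]m+o≡n 3≤b =
  extendᵇ k (solve-large k (cell a c b′)
    (trans (swapᵇᶜ-size (cell a b′ c)) (Embedding.from-size (shift 0 3 0 refl) {cell a b′ c} ∣s∣))
    λ (a≡c , c≡b) → ¬bal (trans a≡c c≡b , sym c≡b))
... | _ | _ | yes 3≤a with a′ , refl ← m≤n⇒∃[o]m+o≡n 3≤a =
  extendᵃ k (solve-large k (cell b c a′)
    (trans (swapᵇᶜ-size (cell b a′ c))
      (trans (swapᵃᵇ-size (cell a′ b c)) (Embedding.from-size (shift 3 0 0 refl) {cell a′ b c} ∣s∣)))
    λ (b≡c , c≡a) → ¬bal (sym (trans b≡c c≡a) , b≡c))
-- Three coordinates of at most 2 sum to at most 6, whereas the size is at least 8.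
... | no 3≰c | no 3≰b | no 3≰a = ⊥-elim (<-irrefl ∣s∣ (≤-trans
  (s≤s (+-mono-≤ (+-mono-≤ (≤-pred (≰⇒> 3≰a)) (≤-pred (≰⇒> 3≰b))) (≤-pred (≰⇒> 3≰c)))) (m≤m+n 7 (1 + k))))

solutions : ∀ k s → ∣ s ∣ ≡ 3 + k → ¬ Balanced s → ∃ (Solves (3 + k) s)
solutions 0             s ∣s∣ ¬bal = let t , _ , r = solve₄ s ∣s∣ ¬bal in t , r
solutions 1             s ∣s∣ ¬bal = let t , _ , r = solve₅ s ∣s∣ ¬bal in t , r
solutions (suc (suc k)) s ∣s∣ ¬bal = let t , _ , r = solve-large k s ∣s∣ ¬bal in t , r

-- Holes and cells

module _ {N : ℕ} where

  toCell : Hole (suc N) → Cell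
  toCell h = cell (x h) (y h ∸ x h) (N ∸ y h)

  x≤y : (h : Hole (suc N)) → x h ≤ y h
  x≤y (hole x y x≤y _) = recompute (x ≤? y) x≤y

  y≤N : (h : Hole (suc N)) → y h ≤ N
  y≤N (hole x y _ y<n) = ≤-pred (recompute (y <? suc N) y<n)

  toCell-size : ∀ h → ∣ toCell h ∣ ≡ N
  toCell-size h = trans (cong (_+ (N ∸ y h)) (m+[n∸m]≡n (x≤y h))) (m+[n∸m]≡n (y≤N h))

  fromCell : (h : Cell) → ∣ h ∣ ≡ N → Hole (suc N)
  fromCell (cell a b c) ∣h∣ = hole a (a + b) (m≤m+n a b) (s≤s (subst (a + b ≤_) ∣h∣ (m≤m+n (a + b) c)))

  toCell-fromCell : ∀ h (∣h∣ : ∣ h ∣ ≡ N) → toCell (fromCell h ∣h∣) ≡ h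
  toCell-fromCell (cell a b c) refl = cong₂ (cell a) (m+n∸m≡n a b) (m+n∸m≡n (a + b) c)

  hole-≡ : ∀ {g h : Hole (suc N)} → x g ≡ x h → y g ≡ y h → g ≡ h
  hole-≡ refl refl = refl

  fromCell-toCell : ∀ {g} h ∣g∣ → toCell h ≡ g → h ≡ fromCell g ∣g∣
  fromCell-toCell h _ refl = hole-≡ refl (sym (m+[n∸m]≡n (x≤y h)))

  toCell-injective : ∀ {g h} → toCell g ≡ toCell h → g ≡ h
  toCell-injective {g} {h} eq =
    trans (fromCell-toCell g (toCell-size h) eq) (sym (fromCell-toCell h (toCell-size h) refl))

coordsᶜ : Cell → ℤ²
coordsᶜ (cell a b c) = + a , + (a + b)

private
  kept : ∀ m → + m ≡ + m ℤ.+ ℤ.0ℤ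
  kept m = cong +_ (sym (+-identityʳ m))

  raised : ∀ m → + suc m ≡ + m ℤ.+ ℤ.1ℤ
  raised m = cong +_ (+-comm 1 m)

line-direction : ∀ {p q r} → Line p q r →
  ∃ λ d → Direction d × coordsᶜ q ≡ coordsᶜ p ⊕ d × coordsᶜ r ≡ coordsᶜ q ⊕ d
line-direction (ab a b c) rewrite +-suc a (suc b) | +-suc a b =
  _ , -x , cong₂ _,_ refl (kept _) , cong₂ _,_ refl (kept _)
line-direction (ba a b c) rewrite +-suc a (suc b) | +-suc a b =
  _ , +x , cong₂ _,_ (raised _) (kept _) , cong₂ _,_ (raised _) (kept _)
line-direction (ac a b c) = _ , -xy , refl , refl
line-direction (ca a b c) =
  _ , +xy , cong₂ _,_ (raised _) (raised _) , cong₂ _,_ (raised _) (raised _)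
line-direction (bc a b c) rewrite +-suc a (suc b) | +-suc a b =
  _ , -y , cong₂ _,_ (kept _) refl , cong₂ _,_ (kept _) refl
line-direction (cb a b c) rewrite +-suc a (suc b) | +-suc a b =
  _ , +y , cong₂ _,_ (kept _) (raised _) , cong₂ _,_ (kept _) (raised _)

coords-fromCell : ∀ {N} h (∣h∣ : ∣ h ∣ ≡ N) → coords (fromCell h ∣h∣) ≡ coordsᶜ h
coords-fromCell (cell a b c) _ = refl

jump : ∀ {N} {P Q : Pegs} {P̂ : Position (suc N)} →
       (∀ h → P̂ h ≡ P (toCell h)) → Step N P Q → Jump P̂ (Q ∘ toCell)
jump {N} {P} {Q} {P̂} P̂≈P s =
  let d , dir , q≡ , r≡ = line-direction line
      q̂≡ = trans (coords-fromCell q q-size) (trans q≡ (cong (_⊕ d) (sym (coords-fromCell p p-size))))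
  in record
    { direction = dir
    ; p = fromCell p p-size ; q = fromCell q q-size ; r = fromCell r r-size
    ; q≡p+d     = q̂≡
    ; r≡p+2d    = trans (coords-fromCell r r-size)
                    (trans r≡ (cong (_⊕ d) (trans (sym (coords-fromCell q q-size)) q̂≡)))
    ; p-before  = before p p-size p-before ; q-before = before q q-size q-before
    ; r-before  = before r r-size r-before
    ; p-after   = at-cell Q p p-size p-after ; q-after = at-cell Q q q-size q-after
    ; r-after   = at-cell Q r r-size r-after
    ; unchanged = λ h h≢p h≢q h≢r → trans
        (unchanged (toCell h) (toCell-size h) (h≢p ∘ fromCell-toCell h p-size)
          (h≢q ∘ fromCell-toCell h q-size) (h≢r ∘ fromCell-toCell h r-size))
        (sym (P̂≈P h)) }
  where
  open Step s
  at-cell : ∀ (R : Pegs) h {v} (∣h∣ : ∣ h ∣ ≡ N) → R h ≡ v → R (toCell (fromCell h ∣h∣)) ≡ v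
  at-cell R h ∣h∣ = trans (cong R (toCell-fromCell h ∣h∣))
  before : ∀ h {v} (∣h∣ : ∣ h ∣ ≡ N) → P h ≡ v → P̂ (fromCell h ∣h∣) ≡ v
  before h ∣h∣ Ph = trans (P̂≈P _) (at-cell P h ∣h∣ Ph)

-- The pointwise hypothesis accommodates the starting position, which is given on holes; every later
-- position is literally a composite with `toCell`.
jumps : ∀ {N} {P Q : Pegs} {P̂ : Position (suc N)} → (∀ h → P̂ h ≡ P (toCell h)) → Reach N P Q →
        ∃ λ Q̂ → P̂ ⟶* Q̂ × (∀ h → Q̂ h ≡ Q (toCell h))
jumps P̂≈P (done P≈Q) = _ , ε , λ h → trans (P̂≈P h) (P≈Q (toCell h) (toCell-size h))
jumps P̂≈P (next s r) = let Q̂ , π , Q̂≈Q = jumps (λ _ → refl) r in Q̂ , jump P̂≈P s ◅ π , Q̂≈Q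

singleVacancy-toCell : ∀ {N} (s h : Hole (suc N)) → singleVacancy s h ≡ vacancy (toCell s) (toCell h)
singleVacancy-toCell s h with h ≟ₕ s
... | yes refl = cong not (sym (dec-true (toCell h ≟ᶜ toCell h) refl))
... | no h≢s   = cong not (sym (dec-false (toCell h ≟ᶜ toCell s) (h≢s ∘ toCell-injective)))

solvable : ∀ {N} (s : Hole (suc N)) {t} → 0 < N → Solves N (toCell s) t → SolvableToOnePeg (singleVacancy s)
solvable s {t} 0<N r =
  let Q , π , Q≈ = jumps (singleVacancy-toCell s) r
      ∣t∣ = solves-size 0<N r
  in Q , π , fromCell t ∣t∣ ,
     trans (Q≈ _) (dec-true (toCell (fromCell t ∣t∣) ≟ᶜ t) (toCell-fromCell t ∣t∣)) ,
     λ {h} Qh → sym (fromCell-toCell h ∣t∣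
       (holds (toCell h ≟ᶜ t) (subst T (sym (trans (sym (Q≈ h)) Qh)) tt)))

sum%3 : ∀ a b c → a % 3 ≡ b % 3 → b % 3 ≡ c % 3 → (a + b + c) % 3 ≡ 0
sum%3 a b c a≡b b≡c = trans (cong (_% 3) regroup) ([m+kn]%n≡m%n 0 (r + (a / 3 + b / 3 + c / 3)) 3)
  where
  r : ℕ
  r = c % 3
  regroup : a + b + c ≡ 0 + (r + (a / 3 + b / 3 + c / 3)) * 3
  regroup = trans
    (cong₂ _+_ (cong₂ _+_
      (trans (m≡m%n+[m/n]*n a 3) (cong (_+ a / 3 * 3) (trans a≡b b≡c)))
      (trans (m≡m%n+[m/n]*n b 3) (cong (_+ b / 3 * 3) b≡c)))
      (m≡m%n+[m/n]*n c 3))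
    (solve 4 (λ r i j k → r :+ i :* con 3 :+ (r :+ j :* con 3) :+ (r :+ k :* con 3) :=
                   con 0 :+ (r :+ (i :+ j :+ k)) :* con 3) refl r (a / 3) (b / 3) (c / 3))
    where open +-*-Solver

balanced-mod : ∀ {N} (s : Hole (suc N)) → Balanced (toCell s) → suc N % 3 ≡ 1 × (x s + y s) % 3 ≡ 0
balanced-mod {N} s (a≡b , b≡c) =
  suc-%3 N (subst (λ m → m % 3 ≡ 0) (toCell-size s) (sum%3 (x s) _ _ a≡b b≡c)) ,
  -- `x + y` equals `a + a + b`, again a sum of three congruent numbers.
  subst (λ m → m % 3 ≡ 0) (trans (+-assoc (x s) (x s) _) (cong (_+_ (x s)) (m+[n∸m]≡n (x≤y s))))
    (sum%3 (x s) (x s) _ refl a≡b)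
  where
  suc-%3 : ∀ m → m % 3 ≡ 0 → suc m % 3 ≡ 1
  suc-%3 0 _ = refl
  suc-%3 (suc (suc (suc m))) m≡0 = suc-%3 m m≡0

-- The colour invariant

open CommutativeSemigroupProperties
  (CommutativeRing.+-commutativeSemigroup xor-∧-commutativeRing) using (interchange; x∙yz≈y∙xz)

⨁ : ℕ → (ℕ → Bool) → Bool
⨁ zero    f = false
⨁ (suc n) f = f n xor ⨁ n f

⨁-cong : ∀ n {f g} → (∀ i → i < n → f i ≡ g i) → ⨁ n f ≡ ⨁ n g
⨁-cong zero    eq = refl
⨁-cong (suc n) eq = cong₂ _xor_ (eq n ≤-refl) (⨁-cong n λ i i<n → eq i (m<n⇒m<1+n i<n))

⨁-false : ∀ n → ⨁ n (λ _ → false) ≡ false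
⨁-false zero    = refl
⨁-false (suc n) = ⨁-false n

⨁-xor : ∀ n f g → ⨁ n (λ i → f i xor g i) ≡ ⨁ n f xor ⨁ n g
⨁-xor zero    f g = refl
⨁-xor (suc n) f g =
  trans (cong ((f n xor g n) xor_) (⨁-xor n f g)) (interchange (f n) (g n) (⨁ n f) (⨁ n g))

⨁-point : ∀ n f {i} → i < n → (∀ j → j ≢ i → f j ≡ false) → ⨁ n f ≡ f i
⨁-point (suc n) f {i} i<1+n off with i ≟ n
... | yes refl = trans (cong (f n xor_) (trans (⨁-cong n λ j j<n → off j (<⇒≢ j<n)) (⨁-false n)))
                       (xor-identityʳ (f n))
... | no i≢n rewrite off n (i≢n ∘ sym) = ⨁-point n f (≤∧≢⇒< (≤-pred i<1+n) i≢n) off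

-- Extension by `false` off the board, so that sums run over plain ranges of naturals.
at : ∀ {n} → Position n → ℕ → ℕ → Bool
at {n} P x y with x ≤? y | y <? n
... | yes x≤y | yes y<n = P (hole x y x≤y y<n)
... | _       | _       = false

∑ : ∀ {n} → (Hole n → Bool) → Bool
∑ {n} P = ⨁ n λ y → ⨁ (suc y) λ x → at P x y

at-hole : ∀ {n} (P : Position n) {x y} → .(x≤y : x ≤ y) → .(y<n : y < n) → at P x y ≡ P (hole x y x≤y y<n)
at-hole {n} P {x} {y} x≤y y<n with x ≤? y | y <? n
... | yes _   | yes _   = refl
... | yes _   | no  y≮n = Irrelevant.⊥-elim (y≮n y<n)
... | no  x≰y | _       = Irrelevant.⊥-elim (x≰y x≤y)

∑-cong : ∀ {n} {P Q : Position n} → (∀ h → P h ≡ Q h) → ∑ P ≡ ∑ Q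
∑-cong {n} {P} {Q} eq = ⨁-cong n λ y y<n → ⨁-cong (suc y) λ x x≤y →
  trans (at-hole P (≤-pred x≤y) y<n) (trans (eq _) (sym (at-hole Q (≤-pred x≤y) y<n)))

∑-xor : ∀ {n} (P Q : Position n) → ∑ (λ h → P h xor Q h) ≡ ∑ P xor ∑ Q
∑-xor {n} P Q = trans
  (⨁-cong n λ y y<n → trans
    (⨁-cong (suc y) λ x x≤y → trans (at-hole _ (≤-pred x≤y) y<n)
      (sym (cong₂ _xor_ (at-hole P (≤-pred x≤y) y<n) (at-hole Q (≤-pred x≤y) y<n))))
    (⨁-xor (suc y) (λ x → at P x y) (λ x → at Q x y)))
  (⨁-xor n _ _)

∑-point : ∀ {n} (P : Position n) h → (∀ g → g ≢ h → P g ≡ false) → ∑ P ≡ P h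
∑-point {n} P h@(hole x₀ y₀ x₀≤y₀ y₀<n) off =
  trans (⨁-point n _ (recompute (y₀ <? n) y₀<n) λ y y≢y₀ →
          trans (⨁-cong (suc y) λ x _ → at-off x y (y≢y₀ ∘ proj₂)) (⨁-false (suc y)))
    (trans (⨁-point (suc y₀) _ (s≤s (recompute (x₀ ≤? y₀) x₀≤y₀)) λ x x≢x₀ → at-off x y₀ (x≢x₀ ∘ proj₁))
      (at-hole P x₀≤y₀ y₀<n))
  where
  at-off : ∀ x y → ¬ (x ≡ x₀ × y ≡ y₀) → at P x y ≡ false
  at-off x y ≢ with x ≤? y | y <? n
  ... | yes x≤y | yes y<n = off (hole x y x≤y y<n) λ eq → ≢ (cong Hole.x eq , cong Hole.y eq)
  ... | yes _   | no  _   = refl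
  ... | no  _   | _       = refl

-- Weights of period three and their totals

-- These weights form a plane over the field with two elements; all of them together amount to the
-- classical Klein four-group invariant of peg solitaire.
record Weight : Set where
  field
    weight  : ℕ → Bool
    period  : ∀ m → weight (3 + m) ≡ weight m
    balance : ∀ m → weight m xor weight (1 + m) xor weight (2 + m) ≡ false

module Invariant (W : Weight) where
  open Weight W

  w : ∀ {n} → Hole n → Bool
  w h = weight (x h + y h)

  total : ∀ {n} → Position n → Bool
  total P = ∑ λ h → w h ∧ P h

  backwards : ∀ {m k} → + m ≡ + k ℤ.+ -1ℤ → k ≡ 1 + m
  backwards {k = suc k} eq = cong suc (sym (ℤ.+-injective eq))

  forwards : ∀ {m k} → + m ≡ + k ℤ.+ 1ℤ → m ≡ 1 + k
  forwards {k = k} eq = trans (ℤ.+-injective eq) (+-comm k 1)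

  same : ∀ {m k} → + m ≡ + k ℤ.+ 0ℤ → m ≡ k
  same {k = k} eq = trans (ℤ.+-injective eq) (+-identityʳ k)


  down : ∀ m → weight (1 + (1 + m)) xor weight (1 + m) xor weight m ≡ false
  down m = trans (reverse (weight (2 + m)) (weight (1 + m)) (weight m)) (balance m)
    where
    reverse : ∀ p q r → p xor q xor r ≡ r xor q xor p
    reverse p q r = trans (cong (p xor_) (xor-comm q r)) (trans (xor-comm p (r xor q)) (xor-assoc r q p))

  -- Along `+x` and `+y` the sum of the coordinates takes three consecutive values. Along `+xy` it
  -- takes `m`, `m + 2`, `m + 4`, and by the period the last counts as `m + 1`. The opposite
  -- directions read the same values backwards.
  line-balance : ∀ {d} → Direction d → ∀ {x₁ y₁ x₂ y₂ x₃ y₃} →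
    (+ x₂ , + y₂) ≡ (+ x₁ , + y₁) ⊕ d → (+ x₃ , + y₃) ≡ (+ x₂ , + y₂) ⊕ d →
    weight (x₁ + y₁) xor weight (x₂ + y₂) xor weight (x₃ + y₃) ≡ false
  line-balance +x e f
    with refl ← forwards (cong proj₁ e) | refl ← same (cong proj₂ e)
       | refl ← forwards (cong proj₁ f) | refl ← same (cong proj₂ f) = balance _
  line-balance -x {x₁} {y₁} {x₂} {y₂} e f
    with refl ← backwards {k = x₁} (cong proj₁ e) | refl ← same (cong proj₂ e)
       | refl ← backwards {k = x₂} (cong proj₁ f) | refl ← same (cong proj₂ f) = down _
  line-balance +y {x₁} {y₁} e f
    with refl ← same (cong proj₁ e) | refl ← forwards (cong proj₂ e)
       | refl ← same (cong proj₁ f) | refl ← forwards (cong proj₂ f)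
    rewrite +-suc x₁ (suc y₁) | +-suc x₁ y₁ = balance _
  line-balance -y {x₁} {y₁} {x₂} {y₂} {x₃} {y₃} e f
    with refl ← same (cong proj₁ e) | refl ← backwards {k = y₁} (cong proj₂ e)
       | refl ← same (cong proj₁ f) | refl ← backwards {k = y₂} (cong proj₂ f)
    rewrite +-suc x₃ (suc y₃) | +-suc x₃ y₃ = down _
  line-balance +xy {x₁} {y₁} e f
    with refl ← forwards (cong proj₁ e) | refl ← forwards (cong proj₂ e)
       | refl ← forwards (cong proj₁ f) | refl ← forwards (cong proj₂ f)
    rewrite +-suc x₁ (suc y₁) | +-suc x₁ y₁ | period (1 + (x₁ + y₁)) =
      trans (cong (weight (x₁ + y₁) xor_) (xor-comm (weight (2 + (x₁ + y₁))) _)) (balance _)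
  line-balance -xy {x₁} {y₁} {x₂} {y₂} {x₃} {y₃} e f
    with refl ← backwards {k = x₁} (cong proj₁ e) | refl ← backwards {k = y₁} (cong proj₂ e)
       | refl ← backwards {k = x₂} (cong proj₁ f) | refl ← backwards {k = y₂} (cong proj₂ f)
    rewrite +-suc x₃ (suc y₃) | +-suc x₃ y₃ | period (1 + (x₃ + y₃)) =
      trans (x∙yz≈y∙xz (weight (1 + (x₃ + y₃))) (weight (2 + (x₃ + y₃))) (weight (x₃ + y₃))) (down _)

  is : ∀ {n} → Hole n → Position n
  is p h = does (h ≟ₕ p)

  is-self : ∀ {n} (p : Hole n) → is p p ≡ true
  is-self p = dec-true (p ≟ₕ p) refl

  is-other : ∀ {n} {p h : Hole n} → h ≢ p → is p h ≡ false
  is-other {p = p} {h} = dec-false (h ≟ₕ p)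

  total-xor : ∀ {n} (P Q : Position n) → total (λ h → P h xor Q h) ≡ total P xor total Q
  total-xor P Q = trans (∑-cong λ h → ∧-distribˡ-xor (w h) (P h) (Q h)) (∑-xor (λ h → w h ∧ P h) (λ h → w h ∧ Q h))

  total-point : ∀ {n} (P : Position n) p → P p ≡ true → (∀ h → h ≢ p → P h ≡ false) → total P ≡ w p
  total-point P p Pp off = trans
    (∑-point _ p λ h h≢p → trans (cong (w h ∧_) (off h h≢p)) (∧-zeroʳ (w h)))
    (trans (cong (w p ∧_) Pp) (∧-identityʳ (w p)))

  total-is : ∀ {n} (p : Hole n) → total (is p) ≡ w p
  total-is p = total-point (is p) p (is-self p) λ h → is-other

  -- Over the field with two elements a jump adds the indicators of its three holes, and `total` is
  -- linear; the sum of the three weights is zero.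
  total-jump : ∀ {n} {P Q : Position n} → Jump P Q → total Q ≡ total P
  total-jump {P = P} {Q} J = trans (∑-cong λ h → cong (w h ∧_) (flips h))
    (trans (total-xor P _) (trans (cong (total P xor_) (trans (total-xor (is p) _)
      (trans (cong₂ _xor_ (total-is p) (trans (total-xor (is q) (is r)) (cong₂ _xor_ (total-is q) (total-is r))))
        (line-balance direction q≡p+d (trans r≡p+2d (cong (_⊕ d) (sym q≡p+d)))))))
      (xor-identityʳ (total P))))
    where
    open Jump J
    differ : ∀ {g h : Hole _} → P g ≡ true → P h ≡ false → g ≢ h
    differ Pg Ph refl with () ← trans (sym Pg) Ph
    -- Both holes carry pegs, so their contents cannot tell them apart as they do for `r`; a
    -- direction is nonzero.
    p≢q : p ≢ q
    p≢q p≡q = no-loop direction (trans (cong coords p≡q) q≡p+d)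
      where
      +1≢ : ∀ {k} → k ≢ 1 + k
      +1≢ ()
      no-loop : ∀ {d} → Direction d → ∀ {x y} → (+ x , + y) ≢ (+ x , + y) ⊕ d
      no-loop +x  e = +1≢ (forwards (cong proj₁ e))
      no-loop -x  {x} e = +1≢ (backwards {k = x} (cong proj₁ e))
      no-loop +y  e = +1≢ (forwards (cong proj₂ e))
      no-loop -y  {y = y} e = +1≢ (backwards {k = y} (cong proj₂ e))
      no-loop +xy e = +1≢ (forwards (cong proj₁ e))
      no-loop -xy {x} e = +1≢ (backwards {k = x} (cong proj₁ e))
    p≢r : p ≢ r
    p≢r = differ p-before r-before
    q≢r : q ≢ r
    q≢r = differ q-before r-before
    flips : ∀ h → Q h ≡ P h xor is p h xor is q h xor is r h
    flips h = by (h ≟ₕ p) (h ≟ₕ q) (h ≟ₕ r)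
      where
      by : Dec (h ≡ p) → Dec (h ≡ q) → Dec (h ≡ r) → Q h ≡ P h xor is p h xor is q h xor is r h
      by (yes refl) _ _ rewrite p-after | p-before | is-self p | is-other p≢q | is-other p≢r = refl
      by _ (yes refl) _ rewrite q-after | q-before | is-self q | is-other (p≢q ∘ sym) | is-other q≢r = refl
      by _ _ (yes refl)
        rewrite r-after | r-before | is-self r | is-other (p≢r ∘ sym) | is-other (q≢r ∘ sym) = refl
      by (no h≢p) (no h≢q) (no h≢r)
        rewrite unchanged h h≢p h≢q h≢r | is-other h≢p | is-other h≢q | is-other h≢r =
          sym (xor-identityʳ (P h))

  total-play : ∀ {n} {P Q : Position n} → P ⟶* Q → total Q ≡ total P
  total-play ε       = refl
  total-play (J ◅ π) = trans (total-play π) (total-jump J)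

  row : ℕ → Bool
  row y = ⨁ (suc y) λ x → weight (x + y)

  -- Three rows further down, each weight repeats by the period, and the three additional holes have
  -- consecutive colours, hence sum zero.
  row-period : ∀ y → row (3 + y) ≡ row y
  row-period y = trans
    (⨁-cong (4 + y) λ x _ → trans (cong weight (x+3+y x)) (period (x + y)))
    (trans (cong (λ m → weight (3 + y + y) xor m) (sym (xor-assoc (weight (2 + y + y)) _ _)))
      (trans (sym (xor-assoc (weight (3 + y + y)) _ _))
        (cong (_xor row y) (down (1 + (y + y))))))
    where
    x+3+y : ∀ x → x + (3 + y) ≡ 3 + (x + y)
    x+3+y x = trans (+-suc x (2 + y)) (cong suc (trans (+-suc x (1 + y)) (cong suc (+-suc x y))))

  rows : ℕ → Bool
  rows n = ⨁ n row

  rows-period : ∀ n → rows (3 + n) ≡ rows n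
  -- The triangle `T_3` has two holes of each colour.
  rows-period zero    rewrite period 0 | period 1 = three (weight 0) (weight 1) (weight 2) (balance 0)
    where
    three : ∀ p q r → p xor q xor r ≡ false →
            (q xor p xor r xor false) xor (r xor q xor false) xor (p xor false) xor false ≡ false
    three false false false _ = refl
    three false true  true  _ = refl
    three true  false true  _ = refl
    three true  true  false _ = refl
  rows-period (suc n) = cong₂ _xor_ (row-period n) (rows-period n)

  total-full : ∀ n → total {n} (λ _ → true) ≡ rows n
  total-full n = ⨁-cong n λ y y<n → ⨁-cong (suc y) λ x x≤y →
    trans (at-hole {n} _ (≤-pred x≤y) y<n) (∧-identityʳ _)

  total-vacancy : ∀ {n} (s : Hole n) → total (singleVacancy s) ≡ rows n xor w s
  -- `not b` is `true xor b` by computation, so the starting position is the full board plus the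
  -- indicator of `s`.
  total-vacancy {n} s = trans (total-xor (λ _ → true) (is s)) (cong₂ _xor_ (total-full n) (total-is s))

  rows-mod : ∀ n → rows n ≡ rows (n % 3)
  rows-mod 0 = refl
  rows-mod 1 = refl
  rows-mod 2 = refl
  rows-mod (suc (suc (suc n))) = trans (rows-period n) (rows-mod n)

  weight-mod : ∀ m → weight m ≡ weight (m % 3)
  weight-mod 0 = refl
  weight-mod 1 = refl
  weight-mod 2 = refl
  weight-mod (suc (suc (suc m))) = trans (period m) (weight-mod m)

  -- For `n ≡ 1` the full board has the total of `T_1`, namely `weight 0`, and a vacancy of colour 0
  -- cancels precisely this. The total zero is then also the weight of the only remaining peg.
  conclusion : ∀ {n} (s t : Hole n) {Q} → n % 3 ≡ 1 → (x s + y s) % 3 ≡ 0 →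
    singleVacancy s ⟶* Q → Q t ≡ true → (∀ h → h ≢ t → Q h ≡ false) → weight (x t + y t) ≡ false
  conclusion {n} s t {Q} n≡1 s≡0 π Qt off =
    trans (sym (total-point Q t Qt off)) (trans (total-play π) (trans (total-vacancy s)
      (trans (cong₂ _xor_ (trans (rows-mod n) (cong rows n≡1)) (trans (weight-mod (x s + y s)) (cong weight s≡0)))
        (trans (cong (_xor weight 0) (trans (cong (_xor false) (xor-identityʳ (weight 0))) (xor-identityʳ (weight 0)))) (xor-same (weight 0))))))

periodic : Bool → Bool → Weight
periodic p q = record { weight = f ; period = λ _ → refl ; balance = f-balance }
  where
  f : ℕ → Bool
  f 0 = p
  f 1 = q
  f 2 = p xor q
  f (suc (suc (suc m))) = f m

  f-balance : ∀ m → f m xor f (1 + m) xor f (2 + m) ≡ false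
  f-balance 0 = trans (sym (xor-assoc p q _)) (xor-same (p xor q))
  f-balance 1 = trans (cong (q xor_) (trans (cong (_xor p) (xor-comm p q)) (trans (xor-assoc q p p)
    (trans (cong (q xor_) (xor-same p)) (xor-identityʳ q))))) (xor-same q)
  f-balance 2 = xor-same (p xor q)
  f-balance (suc (suc (suc m))) = f-balance m

open Weight using (weight)

-- Every colour is seen by some weight, so no hole can hold the last peg when all totals vanish.
separating : ∀ m → ∃ λ W → weight W m ≡ true
separating 0 = periodic true true , refl
separating 1 = periodic true true , refl
separating 2 = periodic true false , refl
separating (suc (suc (suc m))) = let W , eq = separating m in W , trans (Weight.period W m) eq

unsolvable : ∀ {n} (s : Hole n) → n % 3 ≡ 1 → (x s + y s) % 3 ≡ 0 → ¬ SolvableToOnePeg (singleVacancy s)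
unsolvable s n≡1 s≡0 (Q , π , t , Qt , unique) =
  let W , W≡true = separating (x t + y t)
      off h h≢t  = ¬-not λ Qh → h≢t (sym (unique Qh))
  in case trans (sym W≡true) (Invariant.conclusion W s t n≡1 s≡0 π Qt off) of λ ()

theorem2p1 : (n : ℕ) → 4 ≤ n → (s : Hole n) →
    (¬ SolvableToOnePeg (singleVacancy s)) ⇔ (n % 3 ≡ 1 × (x s + y s) % 3 ≡ 0)
theorem2p1 n@(suc (suc (suc (suc k)))) (s≤s (s≤s (s≤s (s≤s z≤n)))) s = mk⇔ only-if λ (n≡1 , s≡0) → unsolvable s n≡1 s≡0
  where
  only-if : ¬ SolvableToOnePeg (singleVacancy s) → n % 3 ≡ 1 × (x s + y s) % 3 ≡ 0
  only-if unsolv with balanced? (toCell s)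
  ... | yes bal = balanced-mod s bal
  ... | no ¬bal = ⊥-elim (unsolv (solvable s z<s (proj₂ (solutions k (toCell s) (toCell-size s) ¬bal))))
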